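{- Let $G$ be a simple graph with $n\geq 2$ vertices and $m$ edges such that $$\sqrt{2n-2m+2\sqrt{2m^{2}+mn(n-1)}}<1+\frac{8m^{2}}{n^{2}(n-1)}+\frac{4m}{n}.$$ Then for every natural number $k\leq n$ in the interval $$\left[\sqrt{2n-2m+2\sqrt{2m^{2}+mn(n-1)}},\; 1+\frac{8m^{2}}{n^{2}(n-1)}+\frac{4m}{n}\right]$$ one has $$S_{k}(G)\leq m+\binom{k+1}{2}.$$
   Context: For a simple graph $G$ on $n$ vertices, the Laplacian matrix is the $n\times n$ matrix $L(G)=D(G)-A(G)$, where $D(G)$ is the diagonal matrix of vertex degrees and $A(G)$ is the adjacency matrix. Its eigenvalues, listed with multiplicity in decreasing order, are the nonnegative reals $\mu_{1}(G)\geq \mu_{2}(G)\geq\cdots\geq\mu_{n}(G)=0$. For $1\leq k\leq n$, $S_{k}(G)=\sum_{i=1}^{k}\mu_{i}(G)$. Brouwer's conjecture for $G$ and $k$ is the inequality $S_{k}(G)\leq m+\binom{k+1}{2}$, where $m$ is the number of edges of $G$. -}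

module Defs where

open import Algebra.Bundles using (RawRing)
import Algebra.Definitions.RawSemiring as RawSemiringDefs
open import Data.Bool.Base using (Bool; false; if_then_else_; _∧_)
open import Data.Fin.Base as Fin using (Fin; zero; suc; toℕ; punchIn; inject≤)
import Data.Fin.Properties as Fin
open import Data.Integer.Base using (+_)
open import Data.Nat.Base as ℕ using (ℕ; zero; suc)
import Data.Nat.Properties as ℕ
open import Data.Product.Base using (∃; _×_; _,_; proj₁; proj₂)
open import Data.Rational.Base as ℚ using (ℚ; 0ℚ; 1ℚ; ½; ∣_∣; _/_)
import Data.Rational.Properties as ℚ
open import Data.Rational.Solver using (module +-*-Solver)
open import Level using (0ℓ)
open import Relation.Binary.PropositionalEquality
  using (_≡_; refl; sym; trans; cong; cong₂; subst)
open import Relation.Nullary.Decidable using (⌊_⌋)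

-- The reals are Cauchy sequences of rationals, taken up to _≈ᵣ_.

Tail : (ℕ → ℚ) → ℚ → Set
Tail x ε = ∃ λ N → ∀ i j → N ℕ.≤ i → N ℕ.≤ j → ∣ x i ℚ.- x j ∣ ℚ.< ε

IsCauchy : (ℕ → ℚ) → Set
IsCauchy x = ∀ ε → 0ℚ ℚ.< ε → Tail x ε

record ℝ : Set where
  constructor mkℝ
  field
    seq    : ℕ → ℚ
    cauchy : IsCauchy seq

open ℝ public

infix 4 _≈ᵣ_ _≤ᵣ_ _<ᵣ_

_≈ᵣ_ : ℝ → ℝ → Set
x ≈ᵣ y = ∀ ε → 0ℚ ℚ.< ε →
  ∃ λ N → ∀ i → N ℕ.≤ i → ∣ seq x i ℚ.- seq y i ∣ ℚ.< ε

_≤ᵣ_ : ℝ → ℝ → Set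
x ≤ᵣ y = ∀ ε → 0ℚ ℚ.< ε →
  ∃ λ N → ∀ i → N ℕ.≤ i → seq x i ℚ.< seq y i ℚ.+ ε

_<ᵣ_ : ℝ → ℝ → Set
x <ᵣ y = ∃ λ ε → 0ℚ ℚ.< ε ×
  (∃ λ N → ∀ i → N ℕ.≤ i → seq x i ℚ.+ ε ℚ.< seq y i)

open +-*-Solver

EventuallyBounded : (ℕ → ℚ) → Set
EventuallyBounded x = ∃ λ B → 0ℚ ℚ.< B × (∃ λ N → ∀ i → N ℕ.≤ i → ∣ x i ∣ ℚ.≤ B)

Scale : ℚ → ℚ → Set
Scale B δ = ∃ λ η → 0ℚ ℚ.< η ×
  (∀ p q → ∣ p ∣ ℚ.≤ B → ∣ q ∣ ℚ.< η → ∣ p ℚ.* q ∣ ℚ.< δ)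

-- Without `abstract`, conversion checking unfolds these proofs inside _*ᵣ_.
abstract
  half>0 : ∀ {ε} → 0ℚ ℚ.< ε → 0ℚ ℚ.< ½ ℚ.* ε
  half>0 {ε} ε>0 = subst (ℚ._< ½ ℚ.* ε) (ℚ.*-zeroʳ ½) (ℚ.*-monoʳ-<-pos ½ ε>0)

  half+half : ∀ ε → ½ ℚ.* ε ℚ.+ ½ ℚ.* ε ≡ ε
  half+half = solve 1 (λ e → con ½ :* e :+ con ½ :* e := e) refl

  const-cauchy : ∀ q → IsCauchy (λ _ → q)
  const-cauchy q ε ε>0 =
    0 , λ _ _ _ _ → subst (λ r → ∣ r ∣ ℚ.< ε) (sym (ℚ.+-inverseʳ q)) ε>0

  neg-cauchy : ∀ x → IsCauchy x → IsCauchy (λ i → ℚ.- x i)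
  neg-cauchy x cx ε ε>0 with cx ε ε>0
  ... | N , h = N , λ i j N≤i N≤j → subst (ℚ._< ε) (sym (eq (x i) (x j))) (h i j N≤i N≤j)
    where
    eq : ∀ a b → ∣ ℚ.- a ℚ.- (ℚ.- b) ∣ ≡ ∣ a ℚ.- b ∣
    eq a b = trans
      (cong ∣_∣ (solve 2 (λ a b → :- a :- (:- b) := :- (a :- b)) refl a b))
      (ℚ.∣-p∣≡∣p∣ (a ℚ.- b))

  ∣+∣-small : ∀ ε p q → ∣ p ∣ ℚ.< ½ ℚ.* ε → ∣ q ∣ ℚ.< ½ ℚ.* ε → ∣ p ℚ.+ q ∣ ℚ.< ε
  ∣+∣-small ε p q hp hq = begin-strict
    ∣ p ℚ.+ q ∣               ≤⟨ ℚ.∣p+q∣≤∣p∣+∣q∣ p q ⟩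
    ∣ p ∣ ℚ.+ ∣ q ∣           <⟨ ℚ.+-mono-< hp hq ⟩
    ½ ℚ.* ε ℚ.+ ½ ℚ.* ε       ≡⟨ half+half ε ⟩
    ε                         ∎
    where open ℚ.≤-Reasoning

  +-difference : ∀ a b c d →
    (a ℚ.+ b) ℚ.- (c ℚ.+ d) ≡ (a ℚ.- c) ℚ.+ (b ℚ.- d)
  +-difference = solve 4
    (λ a b c d → (a :+ b) :- (c :+ d) := (a :- c) :+ (b :- d)) refl

  +-cauchy : ∀ x y → IsCauchy x → IsCauchy y → IsCauchy (λ i → x i ℚ.+ y i)
  +-cauchy x y cx cy ε ε>0 with cx (½ ℚ.* ε) (half>0 ε>0) | cy (½ ℚ.* ε) (half>0 ε>0)
  ... | M , hx | N , hy = M ℕ.⊔ N , λ i j le-i le-j →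
    subst (λ r → ∣ r ∣ ℚ.< ε) (sym (+-difference (x i) (y i) (x j) (y j)))
      (∣+∣-small ε (x i ℚ.- x j) (y i ℚ.- y j)
        (hx i j (ℕ.m⊔n≤o⇒m≤o M N le-i) (ℕ.m⊔n≤o⇒m≤o M N le-j))
        (hy i j (ℕ.m⊔n≤o⇒n≤o M N le-i) (ℕ.m⊔n≤o⇒n≤o M N le-j)))

  0≤∣_∣ : ∀ p → 0ℚ ℚ.≤ ∣ p ∣
  0≤∣ p ∣ = ℚ.nonNegative⁻¹ ∣ p ∣ {{ℚ.∣-∣-nonNeg p}}

  0<1 : 0ℚ ℚ.< 1ℚ
  0<1 = ℚ.positive⁻¹ 1ℚ

  eventually-bounded : ∀ x → IsCauchy x → EventuallyBounded x
  eventually-bounded x cx with cx 1ℚ 0<1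
  ... | N , h = ∣ x N ∣ ℚ.+ 1ℚ , ℚ.+-mono-≤-< (0≤∣ x N ∣) 0<1 , N , bound
    where
    open ℚ.≤-Reasoning
    split : ∀ a b → a ≡ b ℚ.+ (a ℚ.- b)
    split = solve 2 (λ a b → a := b :+ (a :- b)) refl
    bound : ∀ i → N ℕ.≤ i → ∣ x i ∣ ℚ.≤ ∣ x N ∣ ℚ.+ 1ℚ
    bound i N≤i = begin
      ∣ x i ∣                            ≡⟨ cong ∣_∣ (split (x i) (x N)) ⟩
      ∣ x N ℚ.+ (x i ℚ.- x N) ∣          ≤⟨ ℚ.∣p+q∣≤∣p∣+∣q∣ (x N) (x i ℚ.- x N) ⟩
      ∣ x N ∣ ℚ.+ ∣ x i ℚ.- x N ∣        ≤⟨ ℚ.+-monoʳ-≤ ∣ x N ∣ (ℚ.<⇒≤ (h i N N≤i ℕ.≤-refl)) ⟩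
      ∣ x N ∣ ℚ.+ 1ℚ                     ∎

  scale : ∀ {B δ} → 0ℚ ℚ.< B → 0ℚ ℚ.< δ → Scale B δ
  scale {B} {δ} B>0 δ>0 = η , η>0 , small
    where
    open ℚ.≤-Reasoning
    instance
      B-pos : ℚ.Positive B
      B-pos = ℚ.positive B>0
      B-nonZero : ℚ.NonZero B
      B-nonZero = ℚ.pos⇒nonZero B
      1/B-pos : ℚ.Positive (ℚ.1/ B)
      1/B-pos = ℚ.1/pos⇒pos B
    η : ℚ
    η = (ℚ.1/ B) ℚ.* δ
    η>0 : 0ℚ ℚ.< η
    η>0 = subst (ℚ._< η) (ℚ.*-zeroʳ (ℚ.1/ B)) (ℚ.*-monoʳ-<-pos (ℚ.1/ B) δ>0)
    Bη≡δ : B ℚ.* η ≡ δ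
    Bη≡δ = trans (sym (ℚ.*-assoc B (ℚ.1/ B) δ))
      (trans (cong (ℚ._* δ) (ℚ.*-inverseʳ B)) (ℚ.*-identityˡ δ))
    small : ∀ p q → ∣ p ∣ ℚ.≤ B → ∣ q ∣ ℚ.< η → ∣ p ℚ.* q ∣ ℚ.< δ
    small p q p≤B q<η = begin-strict
      ∣ p ℚ.* q ∣       ≡⟨ ℚ.∣p*q∣≡∣p∣*∣q∣ p q ⟩
      ∣ p ∣ ℚ.* ∣ q ∣   ≤⟨ ℚ.*-monoʳ-≤-nonNeg ∣ q ∣ {{ℚ.∣-∣-nonNeg q}} p≤B ⟩
      B ℚ.* ∣ q ∣       <⟨ ℚ.*-monoʳ-<-pos B q<η ⟩
      B ℚ.* η           ≡⟨ Bη≡δ ⟩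
      δ                 ∎

  *-difference : ∀ a b c d →
    a ℚ.* b ℚ.- c ℚ.* d ≡ a ℚ.* (b ℚ.- d) ℚ.+ d ℚ.* (a ℚ.- c)
  *-difference = solve 4
    (λ a b c d → a :* b :- c :* d := a :* (b :- d) :+ d :* (a :- c)) refl

  *-difference-small : ∀ {A B α β ε} a b c d →
    (∀ p q → ∣ p ∣ ℚ.≤ A → ∣ q ∣ ℚ.< α → ∣ p ℚ.* q ∣ ℚ.< ½ ℚ.* ε) →
    (∀ p q → ∣ p ∣ ℚ.≤ B → ∣ q ∣ ℚ.< β → ∣ p ℚ.* q ∣ ℚ.< ½ ℚ.* ε) →
    ∣ a ∣ ℚ.≤ A → ∣ d ∣ ℚ.≤ B → ∣ b ℚ.- d ∣ ℚ.< α → ∣ a ℚ.- c ∣ ℚ.< β →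
    ∣ a ℚ.* b ℚ.- c ℚ.* d ∣ ℚ.< ε
  *-difference-small {ε = ε} a b c d hα hβ a≤A d≤B b-d<α a-c<β =
    subst (λ r → ∣ r ∣ ℚ.< ε) (sym (*-difference a b c d))
      (∣+∣-small ε (a ℚ.* (b ℚ.- d)) (d ℚ.* (a ℚ.- c))
        (hα a (b ℚ.- d) a≤A b-d<α) (hβ d (a ℚ.- c) d≤B a-c<β))

  *-cauchy : ∀ x y → IsCauchy x → IsCauchy y → IsCauchy (λ i → x i ℚ.* y i)
  *-cauchy x y cx cy ε ε>0 =
    combine (eventually-bounded x cx) (eventually-bounded y cy)
    where
    combine₂ : (bx : EventuallyBounded x) (by : EventuallyBounded y) →
      Scale (proj₁ bx) (½ ℚ.* ε) → Scale (proj₁ by) (½ ℚ.* ε) → Tail (λ i → x i ℚ.* y i) ε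
    combine₂ (A , _ , M₁ , bx) (B , _ , N₁ , by) (α , α>0 , sx) (β , β>0 , sy) =
      finish (cx β β>0) (cy α α>0)
      where
      ≤₁ : ∀ m n {o} → m ℕ.⊔ n ℕ.≤ o → m ℕ.≤ o
      ≤₁ m n = ℕ.m⊔n≤o⇒m≤o m n
      ≤₂ : ∀ m n {o} → m ℕ.⊔ n ℕ.≤ o → n ℕ.≤ o
      ≤₂ m n = ℕ.m⊔n≤o⇒n≤o m n
      finish : Tail x β → Tail y α → Tail (λ i → x i ℚ.* y i) ε
      finish (M₂ , hx) (N₂ , hy) = K₁ ℕ.⊔ K₂ , λ i j le-i le-j →
        *-difference-small {A} {B} {α} {β} {ε} (x i) (y i) (x j) (y j) sx sy
          (bx i (≤₁ M₁ N₁ (≤₁ K₁ K₂ le-i))) (by j (≤₂ M₁ N₁ (≤₁ K₁ K₂ le-j)))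
          (hy i j (≤₂ M₂ N₂ (≤₂ K₁ K₂ le-i)) (≤₂ M₂ N₂ (≤₂ K₁ K₂ le-j)))
          (hx i j (≤₁ M₂ N₂ (≤₂ K₁ K₂ le-i)) (≤₁ M₂ N₂ (≤₂ K₁ K₂ le-j)))
        where
        K₁ K₂ : ℕ
        K₁ = M₁ ℕ.⊔ N₁
        K₂ = M₂ ℕ.⊔ N₂

    combine : EventuallyBounded x → EventuallyBounded y → Tail (λ i → x i ℚ.* y i) ε
    combine bx by = combine₂ bx by
      (scale {proj₁ bx} {½ ℚ.* ε} (proj₁ (proj₂ bx)) (half>0 ε>0))
      (scale {proj₁ by} {½ ℚ.* ε} (proj₁ (proj₂ by)) (half>0 ε>0))

infixl 6 _+ᵣ_ _-ᵣ_
infixl 7 _*ᵣ_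
infix  8 -ᵣ_

_+ᵣ_ _*ᵣ_ : ℝ → ℝ → ℝ
x +ᵣ y = mkℝ (λ i → seq x i ℚ.+ seq y i) (+-cauchy (seq x) (seq y) (cauchy x) (cauchy y))
x *ᵣ y = mkℝ (λ i → seq x i ℚ.* seq y i) (*-cauchy (seq x) (seq y) (cauchy x) (cauchy y))

-ᵣ_ : ℝ → ℝ
-ᵣ x = mkℝ (λ i → ℚ.- seq x i) (neg-cauchy (seq x) (cauchy x))

_-ᵣ_ : ℝ → ℝ → ℝ
x -ᵣ y = x +ᵣ (-ᵣ y)

fromℚ : ℚ → ℝ
fromℚ q = mkℝ (λ _ → q) (const-cauchy q)

fromℕ : ℕ → ℝ
fromℕ n = fromℚ (+ n / 1)

0ᵣ 1ᵣ : ℝ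
0ᵣ = fromℚ 0ℚ
1ᵣ = fromℚ 1ℚ

ℝ-rawRing : RawRing 0ℓ 0ℓ
ℝ-rawRing = record
  { Carrier = ℝ
  ; _≈_     = _≈ᵣ_
  ; _+_     = _+ᵣ_
  ; _*_     = _*ᵣ_
  ; -_      = -ᵣ_
  ; 0#      = 0ᵣ
  ; 1#      = 1ᵣ
  }

-- `s IsSqrtOf a` pins s down up to _≈ᵣ_.
infix 4 _IsSqrtOf_

_IsSqrtOf_ : ℝ → ℝ → Set
s IsSqrtOf a = 0ᵣ ≤ᵣ s × s *ᵣ s ≈ᵣ a

module Σℕ = RawSemiringDefs ℕ.+-*-rawSemiring
module Σℝ = RawSemiringDefs (RawRing.rawSemiring ℝ-rawRing)

Matrix : ℕ → Set
Matrix n = Fin n → Fin n → ℝ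

diag : ∀ {n} → (Fin n → ℝ) → Matrix n
diag d i j = if ⌊ i Fin.≟ j ⌋ then d i else 0ᵣ

_-ₘ_ : ∀ {n} → Matrix n → Matrix n → Matrix n
(A -ₘ B) i j = A i j -ᵣ B i j

-- Laplace expansion along the first row.
det : ∀ {n} → Matrix n → ℝ
det {zero}  A = 1ᵣ
det {suc n} A = Σℝ.sum λ j →
  ((-ᵣ 1ᵣ) Σℝ.^ toℕ j) *ᵣ (A zero j *ᵣ det (λ i k → A (suc i) (punchIn j k)))

-- The characteristic polynomial det (xI − A), as a function of x.
charPoly : ∀ {n} → Matrix n → ℝ → ℝ
charPoly A x = det (diag (λ _ → x) -ₘ A)

-- μ lists the eigenvalues of A, repeated according to their multiplicity
-- as roots of the characteristic polynomial, in decreasing order.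
-- ℝ being infinite, an equation between polynomials is the same as one
-- between their values.
record IsSpectrum {n} (A : Matrix n) (μ : Fin n → ℝ) : Set where
  field
    decreasing : ∀ i j → i Fin.≤ j → μ j ≤ᵣ μ i
    roots      : ∀ x → charPoly A x ≈ᵣ Σℝ.product (λ i → x -ᵣ μ i)

record SimpleGraph (n : ℕ) : Set where
  field
    adj    : Fin n → Fin n → Bool
    symm   : ∀ i j → adj i j ≡ adj j i
    irrefl : ∀ i → adj i i ≡ false

module _ {n} (G : SimpleGraph n) where
  open SimpleGraph G

  degree : Fin n → ℕ
  degree i = Σℕ.sum λ j → if adj i j then 1 else 0

  numEdges : ℕ
  numEdges = Σℕ.sum λ i → Σℕ.sum λ j →
    if ⌊ i Fin.<? j ⌋ ∧ adj i j then 1 else 0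

  adjacencyMatrix : Matrix n
  adjacencyMatrix i j = if adj i j then 1ᵣ else 0ᵣ

  laplacian : Matrix n
  laplacian = diag (λ i → fromℕ (degree i)) -ₘ adjacencyMatrix

S : ∀ {n} (μ : Fin n → ℝ) (k : ℕ) → k ℕ.≤ n → ℝ
S μ k k≤n = Σℝ.sum (λ (i : Fin k) → μ (inject≤ i k≤n))

upper : (n m : ℕ) → 2 ℕ.≤ n → ℝ
upper n m n≥2 = fromℚ
  (1ℚ ℚ.+ + (8 ℕ.* m ℕ.^ 2) / (n ℕ.^ 2 ℕ.* (n ℕ.∸ 1)) ℚ.+ + (4 ℕ.* m) / n)
  where
  instance
    n≢0 = ℕ.>-nonZero (ℕ.<⇒≤ n≥2)
    n-1≢0 = ℕ.>-nonZero (ℕ.m<n⇒0<n∸m n≥2)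
    n²≢0 = ℕ.m^n≢0 n 2
    n²*[n-1]≢0 = ℕ.m*n≢0 (n ℕ.^ 2) (n ℕ.∸ 1)

module Submission where

-- No eigenvalue of the Laplacian is negative, so S_k is at most the trace 2m. On the other hand
-- n (n - 1) ≥ 2m gives 2m² + m n (n - 1) ≥ 4m², so the inner root is at least 2m, k² ≥ 2n + 2m, and
-- m + k (k + 1) / 2 ≥ 2m + n. The surplus n leaves room for crude bounds on the eigenvalues: it is
-- enough that μⱼ ≥ -1 and that X = Σ (μⱼ + 1) is at most D + 1, where D = Σ (dⱼ + 1) = 2m + n.
--
-- Both come from one determinant estimate, 1 ≤ det A ≤ Π Aⱼⱼ for a matrix whose off-diagonal entries
-- are nonpositive and whose row sums are at least 1. It is applied to L + s I with s ≥ 1: the lower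
-- bound excludes eigenvalues below -1, and the upper one, at s = t + 1, gives
-- Π (t + (μⱼ + 1)) ≤ Π (t + (dⱼ + 1)). For large t this compares X with D, because the left side is at
-- least tⁿ⁻¹ (t + X) and the right side is at most tⁿ⁺¹ / (t - D).
--
-- Operations on ℝ act index by index, so all determinants are computed over ℚ at a fixed index.

open import Defs
open import Algebra.Bundles using (CommutativeRing; RawRing)
import Algebra.Properties.CommutativeMonoid.Sum as CommutativeMonoidSum
import Algebra.Properties.Semiring.Sum as SemiringSum
open import Data.Bool.Base using (true; false; if_then_else_; _∧_)
open import Data.Bool.Properties using (if-float)
open import Data.Fin.Base as Fin using (Fin; zero; suc; toℕ; punchIn; inject≤)
import Data.Fin.Properties as Fin
open import Data.Nat.Base as ℕ using (ℕ; zero; suc)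
import Data.Nat.Properties as ℕ
open import Data.Product.Base using (∃; _×_; _,_; proj₁; proj₂)
open import Data.Sum.Base using (_⊎_; inj₁; inj₂)
open import Function.Base using (_∘_)
open import Relation.Binary.PropositionalEquality
open import Relation.Nullary.Decidable using (⌊_⌋; yes; no)
open import Relation.Nullary.Negation using (contradiction)

module _ where
  import Data.Integer.Base as ℤ
  import Data.Integer.Properties as ℤ
  import Data.Nat.Coprimality as Coprimality
  open import Data.Rational.Base hiding (floor)
  open import Data.Rational.Properties
  open import Data.Rational.Solver using (module +-*-Solver)
  open import Algebra.Definitions.RawSemiring
    (RawRing.rawSemiring (CommutativeRing.rawRing +-*-commutativeRing)) using (_^_)
  open SemiringSum (CommutativeRing.semiring +-*-commutativeRing)
    using (sum; sum-cong-≗; sum-replicate-zero; *-distribˡ-sum)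
  open CommutativeMonoidSum +-0-commutativeMonoid using (sum-remove; ∑-distrib-+)
  open CommutativeMonoidSum *-1-commutativeMonoid
    using () renaming (sum to product; sum-cong-≗ to product-cong)
  open +-*-Solver
  open ≤-Reasoning

  -- Rational determinants and the effect of adding a vector to one column.

  Matrixℚ : ℕ → Set
  Matrixℚ n = Fin n → Fin n → ℚ

  sgn : ∀ {n} → Fin n → ℚ
  sgn zero    = 1ℚ
  sgn (suc j) = - sgn j

  minor : ∀ {n} → Matrixℚ (suc n) → Fin (suc n) → Matrixℚ n
  minor A j i k = A (suc i) (punchIn j k)

  detℚ : ∀ {n} → Matrixℚ n → ℚ
  detℚ {zero}  A = 1ℚ
  detℚ {suc n} A = sum λ j → sgn j * (A zero j * detℚ (minor A j))

  detℚ-cong : ∀ {n} {A B : Matrixℚ n} → (∀ i j → A i j ≡ B i j) → detℚ A ≡ detℚ B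
  detℚ-cong {zero}  A≗B = refl
  detℚ-cong {suc n} A≗B = sum-cong-≗ λ j →
    cong (sgn j *_) (cong₂ _*_ (A≗B zero j) (detℚ-cong λ i k → A≗B (suc i) (punchIn j k)))

  -- Deleting j and then k is deleting punchIn j k and then punchSwap j k.
  punchSwap : ∀ {n} → Fin (suc n) → Fin n → Fin n
  punchSwap zero    zero    = zero
  punchSwap zero    (suc _) = zero
  punchSwap (suc j) zero    = j
  punchSwap (suc j) (suc k) = suc (punchSwap j k)

  punchIn-punchSwap : ∀ {n} (j : Fin (suc n)) (k : Fin n) →
    punchIn (punchIn j k) (punchSwap j k) ≡ j
  punchIn-punchSwap zero    zero    = refl
  punchIn-punchSwap zero    (suc k) = refl
  punchIn-punchSwap (suc j) zero    = refl
  punchIn-punchSwap (suc j) (suc k) = cong suc (punchIn-punchSwap j k)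

  punchIn-swap : ∀ {n} (j : Fin (suc (suc n))) (k : Fin (suc n)) (c : Fin n) →
    punchIn (punchIn j k) (punchIn (punchSwap j k) c) ≡ punchIn j (punchIn k c)
  punchIn-swap zero    zero    c       = refl
  punchIn-swap zero    (suc k) c       = refl
  punchIn-swap (suc j) zero    c       = refl
  punchIn-swap (suc j) (suc k) zero    = refl
  punchIn-swap (suc j) (suc k) (suc c) = cong suc (punchIn-swap j k c)

  -- Both orders delete the same two columns, but the positions add up to j + k in one order and to
  -- j + k + 1 (if k ≥ j) or j + k - 1 (if k < j) in the other. The parity always flips, which
  -- `suc k` records.
  sgn-punchSwap : ∀ {n} (j : Fin (suc n)) (k : Fin n) →
    sgn (punchIn j k) * sgn (punchSwap j k) ≡ sgn j * sgn (suc k)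
  sgn-punchSwap zero    zero    = refl
  sgn-punchSwap zero    (suc k) = *-comm (- - sgn k) 1ℚ
  sgn-punchSwap (suc j) zero    = solve 1 (λ p → con 1ℚ :* p := :- p :* :- con 1ℚ) refl (sgn j)
  sgn-punchSwap (suc j) (suc k) = begin-equality
    - sgn (punchIn j k) * - sgn (punchSwap j k) ≡⟨ neg² (sgn (punchIn j k)) (sgn (punchSwap j k)) ⟩
    sgn (punchIn j k) * sgn (punchSwap j k)     ≡⟨ sgn-punchSwap j k ⟩
    sgn j * - sgn k                             ≡⟨ neg² (sgn j) (- sgn k) ⟨
    - sgn j * - - sgn k                         ∎
    where
    neg² : ∀ p q → - p * - q ≡ p * q
    neg² = solve 2 (λ p q → :- p :* :- q := p :* q) refl

  -- The Kronecker delta, by recursion rather than by a decision, so that it reduces under `suc` and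
  -- follows `punchIn`.
  δ : ∀ {n} → Fin n → Fin n → ℚ
  δ zero    zero    = 1ℚ
  δ zero    (suc j) = 0ℚ
  δ (suc i) zero    = 0ℚ
  δ (suc i) (suc j) = δ i j

  δ-refl : ∀ {n} (i : Fin n) → δ i i ≡ 1ℚ
  δ-refl zero    = refl
  δ-refl (suc i) = δ-refl i

  δ-punchIn : ∀ {n} (i : Fin (suc n)) (j : Fin n) → δ i (punchIn i j) ≡ 0ℚ
  δ-punchIn zero    j       = refl
  δ-punchIn (suc i) zero    = refl
  δ-punchIn (suc i) (suc j) = δ-punchIn i j

  δ-punchIn-punchIn : ∀ {n} (p : Fin (suc n)) (i j : Fin n) →
    δ (punchIn p i) (punchIn p j) ≡ δ i j
  δ-punchIn-punchIn zero    i       j       = refl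
  δ-punchIn-punchIn (suc p) zero    zero    = refl
  δ-punchIn-punchIn (suc p) zero    (suc j) = refl
  δ-punchIn-punchIn (suc p) (suc i) zero    = refl
  δ-punchIn-punchIn (suc p) (suc i) (suc j) = δ-punchIn-punchIn p i j

  addColumn : ∀ {n} → Matrixℚ n → Fin n → (Fin n → ℚ) → Matrixℚ n
  addColumn N j v i k = N i k + v i * δ j k

  deleteAndPrepend : ∀ {n} → Matrixℚ (suc n) → Fin (suc n) → (Fin (suc n) → ℚ) → Matrixℚ (suc n)
  deleteAndPrepend N j v i zero    = v i
  deleteAndPrepend N j v i (suc k) = N i (punchIn j k)

  0*-elim : ∀ p q {r} → r ≡ 0ℚ → p + q * r ≡ p
  0*-elim p q refl = solve 2 (λ p q → p :+ q :* con 0ℚ := p) refl p q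

  1*-elim : ∀ p q {r} → r ≡ 1ℚ → p + q * r ≡ p + q
  1*-elim p q refl = cong (p +_) (*-identityʳ q)

  -- Linearity in column j. Instead of standing in place j, the vector v is moved to the front past
  -- j columns, whence the factor `sgn j`. Expansion along the first row makes this mutually
  -- recursive with the statement about minors that follows.
  detℚ-addColumn : ∀ {n} (N : Matrixℚ (suc n)) j v →
    detℚ (addColumn N j v) ≡ detℚ N + sgn j * detℚ (deleteAndPrepend N j v)
  -- Deleting the column `punchIn j k` leaves column j in place `punchSwap j k`, so the minor is
  -- again an `addColumn`, of a matrix one size smaller.
  detℚ-minor-addColumn : ∀ {n} (N : Matrixℚ (suc n)) j v k →
    detℚ (minor (addColumn N j v) (punchIn j k)) ≡
    detℚ (minor N (punchIn j k)) +
    sgn (punchSwap j k) * detℚ (minor (deleteAndPrepend N j v) (suc k))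

  detℚ-addColumn {n} N j v = begin-equality
    sum f
      ≡⟨ sum-remove {i = j} f ⟩
    f j + sum (f ∘ punchIn j)
      ≡⟨ cong₂ _+_ f-j (sum-cong-≗ f-punchIn) ⟩
    (g j + sgn j * h zero) + sum (λ k → g (punchIn j k) + sgn j * h (suc k))
      ≡⟨ cong (g j + sgn j * h zero +_) (∑-distrib-+ (g ∘ punchIn j) _) ⟩
    (g j + sgn j * h zero) + (sum (g ∘ punchIn j) + sum (λ k → sgn j * h (suc k)))
      ≡⟨ cong (λ s → (g j + sgn j * h zero) + (sum (g ∘ punchIn j) + s)) (*-distribˡ-sum (sgn j) (h ∘ suc)) ⟨
    (g j + sgn j * h zero) + (sum (g ∘ punchIn j) + sgn j * sum (h ∘ suc))
      ≡⟨ solve 5 (λ a s b c d → (a :+ s :* b) :+ (c :+ s :* d) := (a :+ c) :+ s :* (b :+ d)) refl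
           (g j) (sgn j) (h zero) (sum (g ∘ punchIn j)) (sum (h ∘ suc)) ⟩
    (g j + sum (g ∘ punchIn j)) + sgn j * sum h
      ≡⟨ cong (_+ sgn j * sum h) (sum-remove {i = j} g) ⟨
    sum g + sgn j * sum h
      ∎
    where
    E M : Matrixℚ (suc n)
    E = addColumn N j v
    M = deleteAndPrepend N j v
    f g h : Fin (suc n) → ℚ
    f p = sgn p * (E zero p * detℚ (minor E p))
    g p = sgn p * (N zero p * detℚ (minor N p))
    h p = sgn p * (M zero p * detℚ (minor M p))
    -- The minor at j no longer contains v; only the entry in row zero changes, and its extra
    -- `v zero` gives the leading term in the expansion of `M`.
    f-j : f j ≡ g j + sgn j * h zero
    f-j = begin-equality
      sgn j * (E zero j * detℚ (minor E j))
        ≡⟨ cong (sgn j *_) (cong₂ _*_ (1*-elim (N zero j) (v zero) (δ-refl j))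
             (detℚ-cong λ i k → 0*-elim _ (v (suc i)) (δ-punchIn j k))) ⟩
      sgn j * ((N zero j + v zero) * detℚ (minor N j))
        ≡⟨ solve 4 (λ s a b d → s :* ((a :+ b) :* d) := s :* (a :* d) :+ s :* (con 1ℚ :* (b :* d))) refl
             (sgn j) (N zero j) (v zero) (detℚ (minor N j)) ⟩
      g j + sgn j * h zero
        ∎
    f-punchIn : ∀ k → f (punchIn j k) ≡ g (punchIn j k) + sgn j * h (suc k)
    f-punchIn k = begin-equality
      sgn p * (E zero p * detℚ (minor E p))
        ≡⟨ cong (sgn p *_) (cong₂ _*_ (0*-elim (N zero p) (v zero) (δ-punchIn j k))
             (detℚ-minor-addColumn N j v k)) ⟩
      sgn p * (a * (d + s * e))
        ≡⟨ solve 5 (λ q a d s e → q :* (a :* (d :+ s :* e)) := q :* (a :* d) :+ (q :* s) :* (a :* e)) refl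
             (sgn p) a d s e ⟩
      g p + (sgn p * s) * (a * e)
        ≡⟨ cong (λ z → g p + z * (a * e)) (sgn-punchSwap j k) ⟩
      g p + (sgn j * sgn (suc k)) * (a * e)
        ≡⟨ cong (g p +_) (*-assoc (sgn j) (sgn (suc k)) (a * e)) ⟩
      g p + sgn j * h (suc k)
        ∎
      where
      p = punchIn j k
      a d s e : ℚ
      a = N zero p
      d = detℚ (minor N p)
      s = sgn (punchSwap j k)
      e = detℚ (minor M (suc k))

  detℚ-minor-addColumn {suc n} N j v k = begin-equality
    detℚ (minor (addColumn N j v) p)
      ≡⟨ detℚ-cong (λ i c → cong (λ z → N (suc i) (punchIn p c) + v (suc i) * z) (δ-swap c)) ⟩
    detℚ (addColumn (minor N p) q (v ∘ suc))
      ≡⟨ detℚ-addColumn (minor N p) q (v ∘ suc) ⟩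
    detℚ (minor N p) + sgn q * detℚ (deleteAndPrepend (minor N p) q (v ∘ suc))
      ≡⟨ cong (λ z → detℚ (minor N p) + sgn q * z) (detℚ-cong prepend-swap) ⟩
    detℚ (minor N p) + sgn q * detℚ (minor (deleteAndPrepend N j v) (suc k))
      ∎
    where
    p = punchIn j k
    q = punchSwap j k
    δ-swap : ∀ c → δ j (punchIn p c) ≡ δ q c
    δ-swap c = trans (cong (λ z → δ z (punchIn p c)) (sym (punchIn-punchSwap j k)))
      (δ-punchIn-punchIn p q c)
    prepend-swap : ∀ i c → deleteAndPrepend (minor N p) q (v ∘ suc) i c ≡
      minor (deleteAndPrepend N j v) (suc k) i c
    prepend-swap i zero    = refl
    prepend-swap i (suc c) = cong (N (suc i)) (punchIn-swap j k c)

  -- Inequalities between rational sums and products.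

  *-nonNeg : ∀ {p q} → 0ℚ ≤ p → 0ℚ ≤ q → 0ℚ ≤ p * q
  *-nonNeg {p} {q} 0≤p 0≤q = nonNegative⁻¹ (p * q)
    {{nonNeg*nonNeg⇒nonNeg p {{nonNegative 0≤p}} q {{nonNegative 0≤q}}}}

  *-monoˡ : ∀ {p q} r → 0ℚ ≤ r → p ≤ q → r * p ≤ r * q
  *-monoˡ r 0≤r = *-monoˡ-≤-nonNeg r {{nonNegative 0≤r}}

  *-mono : ∀ {p q r s} → 0ℚ ≤ p → p ≤ q → 0ℚ ≤ r → r ≤ s → p * r ≤ q * s
  *-mono {p} {q} {r} {s} 0≤p p≤q 0≤r r≤s = ≤-trans (*-monoˡ p 0≤p r≤s)
    (*-monoʳ-≤-nonNeg s {{nonNegative (≤-trans 0≤r r≤s)}} p≤q)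

  ≡+⇒≤ : ∀ {p q} r → 0ℚ ≤ r → q ≡ p + r → p ≤ q
  ≡+⇒≤ {p} {q} r 0≤r q≡p+r = begin
    p      ≡⟨ +-identityʳ p ⟨
    p + 0ℚ ≤⟨ +-monoʳ-≤ p 0≤r ⟩
    p + r  ≡⟨ q≡p+r ⟨
    q      ∎

  0≤1 : 0ℚ ≤ 1ℚ
  0≤1 = nonNegative⁻¹ 1ℚ

  neg-nonNeg : ∀ {p} → p ≤ 0ℚ → 0ℚ ≤ - p
  neg-nonNeg = neg-antimono-≤

  sum-mono : ∀ {n} {f g : Fin n → ℚ} → (∀ i → f i ≤ g i) → sum f ≤ sum g
  sum-mono {zero}  f≤g = ≤-refl
  sum-mono {suc n} f≤g = +-mono-≤ (f≤g zero) (sum-mono (f≤g ∘ suc))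

  sum-nonNeg : ∀ {n} {f : Fin n → ℚ} → (∀ i → 0ℚ ≤ f i) → 0ℚ ≤ sum f
  sum-nonNeg {zero}  0≤f = ≤-refl
  sum-nonNeg {suc n} 0≤f = +-mono-≤ (0≤f zero) (sum-nonNeg (0≤f ∘ suc))

  sum-nonPos : ∀ {n} {f : Fin n → ℚ} → (∀ i → f i ≤ 0ℚ) → sum f ≤ 0ℚ
  sum-nonPos {zero}  f≤0 = ≤-refl
  sum-nonPos {suc n} f≤0 = +-mono-≤ (f≤0 zero) (sum-nonPos (f≤0 ∘ suc))

  product-nonNeg : ∀ {n} {f : Fin n → ℚ} → (∀ i → 0ℚ ≤ f i) → 0ℚ ≤ product f
  product-nonNeg {zero}  0≤f = 0≤1
  product-nonNeg {suc n} 0≤f = *-nonNeg (0≤f zero) (product-nonNeg (0≤f ∘ suc))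

  product-mono : ∀ {n} {f g : Fin n → ℚ} → (∀ i → 0ℚ ≤ f i) → (∀ i → f i ≤ g i) →
    product f ≤ product g
  product-mono {zero}  0≤f f≤g = ≤-refl
  product-mono {suc n} 0≤f f≤g =
    *-mono (0≤f zero) (f≤g zero) (product-nonNeg (0≤f ∘ suc)) (product-mono (0≤f ∘ suc) (f≤g ∘ suc))

  δ-nonNeg : ∀ {n} (i j : Fin n) → 0ℚ ≤ δ i j
  δ-nonNeg zero    zero    = 0≤1
  δ-nonNeg zero    (suc j) = ≤-refl
  δ-nonNeg (suc i) zero    = ≤-refl
  δ-nonNeg (suc i) (suc j) = δ-nonNeg i j

  sum-δ : ∀ {n} (i : Fin n) → sum (δ i) ≡ 1ℚ
  sum-δ {suc n} i = begin-equality
    sum (δ i)                           ≡⟨ sum-remove {i = i} (δ i) ⟩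
    δ i i + sum (λ j → δ i (punchIn i j)) ≡⟨ cong₂ _+_ (δ-refl i) (sum-cong-≗ (δ-punchIn i)) ⟩
    1ℚ + sum {n} (λ _ → 0ℚ)             ≡⟨ cong (1ℚ +_) (sum-replicate-zero n) ⟩
    1ℚ                                  ∎

  -- Strictly diagonally dominant matrices with the sign pattern of M-matrices, and bounds for their
  -- determinants.

  record Dominant {n} (A : Matrixℚ n) : Set where
    field
      offDiagonal : ∀ i j → i ≢ j → A i j ≤ 0ℚ
      rowSum      : ∀ i → 1ℚ ≤ sum (A i)

  open Dominant

  diagonal-nonNeg : ∀ {n} {A : Matrixℚ n} → Dominant A → ∀ i → 0ℚ ≤ A i i
  diagonal-nonNeg {suc n} {A} dom i = begin
    0ℚ                                ≤⟨ 0≤1 ⟩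
    1ℚ                                ≤⟨ rowSum dom i ⟩
    sum (A i)                         ≡⟨ sum-remove {i = i} (A i) ⟩
    A i i + sum (A i ∘ punchIn i)     ≤⟨ +-monoʳ-≤ (A i i) (sum-nonPos λ j →
                                           offDiagonal dom i (punchIn i j) (Fin.punchInᵢ≢i i j ∘ sym)) ⟩
    A i i + 0ℚ                        ≡⟨ +-identityʳ (A i i) ⟩
    A i i                             ∎

  corner : ∀ {n} → Matrixℚ (suc n) → Matrixℚ n
  corner A = minor A zero

  -- Column zero is merged into column `suc j` rather than discarded, which keeps the sums of the
  -- remaining rows; for a Laplacian this resembles the contraction of an edge.
  foldColumn : ∀ {n} → Matrixℚ (suc n) → Fin n → Matrixℚ n
  foldColumn A j = addColumn (corner A) j (λ i → A (suc i) zero)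

  column≤0 : ∀ {n} {A : Matrixℚ (suc n)} → Dominant A → ∀ i → A (suc i) zero ≤ 0ℚ
  column≤0 dom i = offDiagonal dom (suc i) zero λ ()

  foldColumn≤corner : ∀ {n} {A : Matrixℚ (suc n)} → Dominant A → ∀ j i k →
    foldColumn A j i k ≤ corner A i k
  foldColumn≤corner {A = A} dom j i k = ≡+⇒≤ (- A (suc i) zero * δ j k)
    (*-nonNeg (neg-nonNeg (column≤0 dom i)) (δ-nonNeg j k))
    (solve 3 (λ a v d → a := (a :+ v :* d) :+ :- v :* d) refl (corner A i k) (A (suc i) zero) (δ j k))

  -- The entry removed from each row is off the diagonal, hence nonpositive, so row sums can only
  -- grow.
  corner-dominant : ∀ {n} {A : Matrixℚ (suc n)} → Dominant A → Dominant (corner A)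
  corner-dominant {A = A} dom = record
    { offDiagonal = λ i j i≢j → offDiagonal dom (suc i) (suc j) (i≢j ∘ Fin.suc-injective)
    ; rowSum      = λ i → ≤-trans (rowSum dom (suc i))
        (≤-trans (+-monoˡ-≤ (sum (corner A i)) (column≤0 dom i)) (≤-reflexive (+-identityˡ _)))
    }

  -- Folding adds nonpositive numbers to entries of the corner, which preserves the sign condition,
  -- and leaves each row sum as it was in A.
  foldColumn-dominant : ∀ {n} {A : Matrixℚ (suc n)} → Dominant A → ∀ j → Dominant (foldColumn A j)
  foldColumn-dominant {n} {A} dom j = record
    { offDiagonal = λ i k i≢k → ≤-trans (foldColumn≤corner dom j i k)
        (offDiagonal (corner-dominant dom) i k i≢k)
    ; rowSum      = λ i → ≤-trans (rowSum dom (suc i)) (≤-reflexive (row i))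
    }
    where
    row : ∀ i → sum (A (suc i)) ≡ sum (foldColumn A j i)
    row i = begin-equality
      v + sum (corner A i)                    ≡⟨ +-comm v _ ⟩
      sum (corner A i) + v                    ≡⟨ 1*-elim (sum (corner A i)) v (sum-δ j) ⟨
      sum (corner A i) + v * sum (δ j)        ≡⟨ cong (sum (corner A i) +_) (*-distribˡ-sum v (δ j)) ⟩
      sum (corner A i) + sum (λ k → v * δ j k) ≡⟨ ∑-distrib-+ (corner A i) _ ⟨
      sum (foldColumn A j i)                  ∎
      where v = A (suc i) zero

  -- If s is the sum of row zero, that row is s e₀ + Σⱼ (- A₀ⱼ) (e₀ - eⱼ), and replacing it by e₀ - eⱼ
  -- has the same effect on the determinant as folding column zero into column j.
  detℚ-foldColumns : ∀ {n} (A : Matrixℚ (suc n)) →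
    detℚ A ≡ sum (A zero) * detℚ (corner A) +
             sum (λ j → - A zero (suc j) * detℚ (foldColumn A j))
  detℚ-foldColumns {n} A = begin-equality
    1ℚ * (A zero zero * d) + sum (λ j → - sgn j * (a j * detℚ (minor A (suc j))))
      ≡⟨ cong (1ℚ * (A zero zero * d) +_) (trans (sum-cong-≗ term) (∑-distrib-+ (λ j → d * a j) _)) ⟩
    1ℚ * (A zero zero * d) + (sum (λ j → d * a j) + e)
      ≡⟨ cong (λ z → 1ℚ * (A zero zero * d) + (z + e)) (*-distribˡ-sum d a) ⟨
    1ℚ * (A zero zero * d) + (d * sum a + e)
      ≡⟨ solve 4 (λ x d s e → con 1ℚ :* (x :* d) :+ (d :* s :+ e) := (x :+ s) :* d :+ e) refl
           (A zero zero) d (sum a) e ⟩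
    sum (A zero) * d + e
      ∎
    where
    d e : ℚ
    d = detℚ (corner A)
    e = sum λ j → - A zero (suc j) * detℚ (foldColumn A j)
    a : Fin n → ℚ
    a j = A zero (suc j)
    fold : ∀ {n} (A : Matrixℚ (suc n)) j →
      detℚ (foldColumn A j) ≡ detℚ (corner A) + sgn j * detℚ (minor A (suc j))
    fold {suc n} A j = trans (detℚ-addColumn (corner A) j v)
      (cong (λ z → detℚ (corner A) + sgn j * z)
        (detℚ-cong {A = deleteAndPrepend (corner A) j v} {minor A (suc j)}
          λ { i zero → refl ; i (suc k) → refl }))
      where
      v : Fin (suc n) → ℚ
      v i = A (suc i) zero
    term : ∀ j → - sgn j * (a j * detℚ (minor A (suc j))) ≡ d * a j + - a j * detℚ (foldColumn A j)
    term j = begin-equality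
      - sgn j * (a j * m)
        ≡⟨ solve 4 (λ s a m d → :- s :* (a :* m) := d :* a :+ :- a :* (d :+ s :* m)) refl (sgn j) (a j) m d ⟩
      d * a j + - a j * (d + sgn j * m)
        ≡⟨ cong (λ z → d * a j + - a j * z) (fold A j) ⟨
      d * a j + - a j * detℚ (foldColumn A j)
        ∎
      where m = detℚ (minor A (suc j))

  -- In `detℚ-foldColumns` every coefficient is nonnegative and every smaller determinant is at
  -- least 1 by induction; the first term alone, a product of two factors at least 1, suffices.
  1≤detℚ : ∀ {n} {A : Matrixℚ n} → Dominant A → 1ℚ ≤ detℚ A
  1≤detℚ {zero}      dom = ≤-refl
  1≤detℚ {suc n} {A} dom = begin
    1ℚ * 1ℚ + 0ℚ
      ≤⟨ +-mono-≤
           (*-mono 0≤1 (rowSum dom zero) 0≤1 (1≤detℚ (corner-dominant dom)))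
           (sum-nonNeg λ j → *-nonNeg (neg-nonNeg (offDiagonal dom zero (suc j) λ ()))
             (≤-trans 0≤1 (1≤detℚ (foldColumn-dominant dom j)))) ⟩
    sum (A zero) * detℚ (corner A) + sum (λ j → - A zero (suc j) * detℚ (foldColumn A j))
      ≡⟨ detℚ-foldColumns A ⟨
    detℚ A
      ∎

  -- Folding only lowers diagonal entries, so by induction every smaller determinant in
  -- `detℚ-foldColumns` is at most the diagonal product `P` of the corner. The coefficients of `P`
  -- add up to `A zero zero`.
  detℚ≤product : ∀ {n} {A : Matrixℚ n} → Dominant A → detℚ A ≤ product (λ i → A i i)
  detℚ≤product {zero}      dom = ≤-refl
  detℚ≤product {suc n} {A} dom = begin
    detℚ A
      ≡⟨ detℚ-foldColumns A ⟩
    sum (A zero) * detℚ (corner A) + sum (λ j → - A zero (suc j) * detℚ (foldColumn A j))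
      ≤⟨ +-mono-≤
           (*-monoˡ (sum (A zero)) (≤-trans 0≤1 (rowSum dom zero)) (detℚ≤product (corner-dominant dom)))
           (sum-mono λ j → *-monoˡ (- A zero (suc j)) (neg-nonNeg (offDiagonal dom zero (suc j) λ ()))
             (≤-trans (detℚ≤product (foldColumn-dominant dom j))
               (product-mono (diagonal-nonNeg (foldColumn-dominant dom j))
                 (λ i → foldColumn≤corner dom j i i)))) ⟩
    sum (A zero) * P + sum (λ j → - A zero (suc j) * P)
      ≡⟨ cong (sum (A zero) * P +_) (trans (sum-cong-≗ λ j → -a*P≡-P*a (A zero (suc j)))
           (sym (*-distribˡ-sum (- P) (A zero ∘ suc)))) ⟩
    sum (A zero) * P + - P * sum (A zero ∘ suc)
      ≡⟨ solve 3 (λ a s p → (a :+ s) :* p :+ :- p :* s := a :* p) refl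
           (A zero zero) (sum (A zero ∘ suc)) P ⟩
    A zero zero * P
      ∎
    where
    P : ℚ
    P = product λ i → corner A i i
    -a*P≡-P*a : ∀ a → - a * P ≡ - P * a
    -a*P≡-P*a a = solve 2 (λ a p → :- a :* p := :- p :* a) refl a P

  -- Comparing sums through products of shifted factors.

  ^-nonNeg : ∀ {t} → 0ℚ ≤ t → ∀ n → 0ℚ ≤ t ^ n
  ^-nonNeg 0≤t zero    = 0≤1
  ^-nonNeg 0≤t (suc n) = *-nonNeg 0≤t (^-nonNeg 0≤t n)

  1≤^ : ∀ {t} → 1ℚ ≤ t → ∀ n → 1ℚ ≤ t ^ n
  1≤^ 1≤t zero    = ≤-refl
  1≤^ 1≤t (suc n) = *-mono 0≤1 1≤t 0≤1 (1≤^ 1≤t n)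

  -- Induction through (t + a) (t - (a + s)) = t (t - s) - a (a + s), where a is the first value and
  -- s the sum of the others. The form avoids dividing by t - Σ d.
  product-upper : ∀ {n t} (d : Fin n → ℚ) → 0ℚ ≤ t → (∀ i → 0ℚ ≤ d i) →
    product (λ i → t + d i) * (t - sum d) ≤ t ^ suc n
  product-upper {zero} {t} d 0≤t 0≤d = ≤-reflexive
    (solve 1 (λ t → con 1ℚ :* (t :- con 0ℚ) := t :* con 1ℚ) refl t)
  product-upper {suc n} {t} d 0≤t 0≤d = begin
    (t + a) * P * (t - (a + s))
      ≤⟨ ≡+⇒≤ (P * (a * (a + s))) (*-nonNeg (product-nonNeg λ i → +-mono-≤ 0≤t (0≤d (suc i)))
           (*-nonNeg (0≤d zero) (+-mono-≤ (0≤d zero) (sum-nonNeg (0≤d ∘ suc)))))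
           (solve 4 (λ t a s p → t :* (p :* (t :- s)) := (t :+ a) :* p :* (t :- (a :+ s)) :+ p :* (a :* (a :+ s)))
             refl t a s P) ⟩
    t * (P * (t - s))
      ≤⟨ *-monoˡ t 0≤t (product-upper (d ∘ suc) 0≤t (0≤d ∘ suc)) ⟩
    t * t ^ suc n
      ∎
    where
    a = d zero
    s = sum (d ∘ suc)
    P = product λ i → t + d (suc i)

  -- The two top powers of t in the expanded product, the rest being nonnegative. The factor t on
  -- both sides avoids the exponent n - 1.
  product-lower : ∀ {n t} (x : Fin n → ℚ) → 0ℚ ≤ t → (∀ i → 0ℚ ≤ x i) →
    t ^ n * (t + sum x) ≤ t * product (λ i → t + x i)
  product-lower {zero} {t} x 0≤t 0≤x = ≤-reflexive
    (solve 1 (λ t → con 1ℚ :* (t :+ con 0ℚ) := t :* con 1ℚ) refl t)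
  product-lower {suc n} {t} x 0≤t 0≤x = begin
    t * t ^ n * (t + (a + s))
      ≤⟨ ≡+⇒≤ (t ^ n * (a * s)) (*-nonNeg (^-nonNeg 0≤t n)
           (*-nonNeg (0≤x zero) (sum-nonNeg (0≤x ∘ suc))))
           (solve 4 (λ t a s p → (t :+ a) :* (p :* (t :+ s)) := t :* p :* (t :+ (a :+ s)) :+ p :* (a :* s))
             refl t a s (t ^ n)) ⟩
    (t + a) * (t ^ n * (t + s))
      ≤⟨ *-monoˡ (t + a) (+-mono-≤ 0≤t (0≤x zero)) (product-lower (x ∘ suc) 0≤t (0≤x ∘ suc)) ⟩
    (t + a) * (t * Q)
      ≡⟨ solve 3 (λ t b q → b :* (t :* q) := t :* (b :* q)) refl t (t + a) Q ⟩
    t * ((t + a) * Q)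
      ∎
    where
    a = x zero
    s = sum (x ∘ suc)
    Q = product λ i → t + x (suc i)

  -- For t = largePoint D one has t - D = D² + 1 and t D + 1 = (D + 1) (D² + 1), so that
  -- (t + X) (t - D) ≤ t² + 1 amounts to X ≤ D + 1.
  largePoint : ℚ → ℚ
  largePoint D = D * D + D + 1ℚ

  -- Chaining the two product bounds and cancelling `t ^ N` compares X with D. The `+ 1ℚ` between
  -- the products makes room for the error at a single index of a Cauchy sequence; it contributes t
  -- u, which is at most `t ^ N` because there are at least two factors.
  sum-bound : ∀ {n} (x d : Fin (suc (suc n)) → ℚ) → (∀ i → 0ℚ ≤ x i) → (∀ i → 0ℚ ≤ d i) →
    let t = largePoint (sum d) in
    product (λ i → t + x i) ≤ product (λ i → t + d i) + 1ℚ → sum x ≤ sum d + 1ℚ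
  sum-bound {n} x d 0≤x 0≤d Q≤P+1 = *-cancelʳ-≤-pos u {{positive 0<u}} (begin
    X * u
      ≡⟨ solve 2 (λ x d → let t = d :* d :+ d :+ con 1ℚ ; u = d :* d :+ con 1ℚ in
           x :* u := u :* (t :+ x) :- t :* u) refl X D ⟩
    u * (t + X) - t * u
      ≤⟨ +-monoˡ-≤ (- (t * u)) (*-cancelˡ-≤-pos (t ^ N) {{positive 0<tᴺ}} scaled) ⟩
    (t * t + 1ℚ) - t * u
      ≡⟨ solve 1 (λ d → let t = d :* d :+ d :+ con 1ℚ ; u = d :* d :+ con 1ℚ in
           (t :* t :+ con 1ℚ) :- t :* u := (d :+ con 1ℚ) :* u) refl D ⟩
    (D + 1ℚ) * u
      ∎)
    where
    N = suc (suc n)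
    D X t u P Q : ℚ
    D = sum d
    X = sum x
    t = largePoint D
    u = D * D + 1ℚ
    P = product λ i → t + d i
    Q = product λ i → t + x i
    0≤D : 0ℚ ≤ D
    0≤D = sum-nonNeg 0≤d
    1≤u : 1ℚ ≤ u
    1≤u = ≤-trans (≤-reflexive (sym (+-identityˡ 1ℚ))) (+-monoˡ-≤ 1ℚ (*-nonNeg 0≤D 0≤D))
    0≤u : 0ℚ ≤ u
    0≤u = ≤-trans 0≤1 1≤u
    0<u : 0ℚ < u
    0<u = <-≤-trans 0<1 1≤u
    u≤t : u ≤ t
    u≤t = ≡+⇒≤ D 0≤D (solve 1 (λ d → d :* d :+ d :+ con 1ℚ := d :* d :+ con 1ℚ :+ d) refl D)
    1≤t : 1ℚ ≤ t
    1≤t = ≤-trans 1≤u u≤t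
    0≤t : 0ℚ ≤ t
    0≤t = ≤-trans 0≤1 1≤t
    0<tᴺ : 0ℚ < t ^ N
    0<tᴺ = <-≤-trans 0<1 (1≤^ 1≤t N)
    t*u≤tᴺ : t * u ≤ t ^ N
    t*u≤tᴺ = *-monoˡ t 0≤t (begin
      u            ≤⟨ u≤t ⟩
      t            ≡⟨ *-identityʳ t ⟨
      t * 1ℚ       ≤⟨ *-monoˡ t 0≤t (1≤^ 1≤t n) ⟩
      t * t ^ n    ∎)
    scaled : t ^ N * (u * (t + X)) ≤ t ^ N * (t * t + 1ℚ)
    scaled = begin
      t ^ N * (u * (t + X))
        ≡⟨ solve 3 (λ a b c → a :* (b :* c) := b :* (a :* c)) refl (t ^ N) u (t + X) ⟩
      u * (t ^ N * (t + X))
        ≤⟨ *-monoˡ u 0≤u (product-lower x 0≤t 0≤x) ⟩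
      u * (t * Q)
        ≤⟨ *-monoˡ u 0≤u (*-monoˡ t 0≤t Q≤P+1) ⟩
      u * (t * (P + 1ℚ))
        -- Since u = t - D, the term u t P becomes t times the left side of `product-upper`.
        ≡⟨ solve 2 (λ d p → let t = d :* d :+ d :+ con 1ℚ ; u = d :* d :+ con 1ℚ in
             u :* (t :* (p :+ con 1ℚ)) := t :* (p :* (t :- d)) :+ t :* u) refl D P ⟩
      t * (P * (t - D)) + t * u
        ≤⟨ +-mono-≤ (*-monoˡ t 0≤t (product-upper d 0≤t 0≤d)) t*u≤tᴺ ⟩
      t * (t * t ^ N) + t ^ N
        ≡⟨ solve 2 (λ t p → t :* (t :* p) :+ p := p :* (t :* t :+ con 1ℚ)) refl t (t ^ N) ⟩
      t ^ N * (t * t + 1ℚ)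
        ∎

  -- Naturals as rationals, and real sums, products and determinants at one index.

  embed : ℕ → ℚ
  embed n = ℤ.+ n / 1

  -- For a variable n the division by 1 is stuck on a gcd; the explicit fraction lets rational
  -- addition and multiplication compute.
  embed-mkℚ : ∀ n → embed n ≡ mkℚ (ℤ.+ n) 0 (Coprimality.sym (Coprimality.1-coprimeTo n))
  embed-mkℚ n = normalize-coprime (Coprimality.sym (Coprimality.1-coprimeTo n))

  embed-+ : ∀ m n → embed (m ℕ.+ n) ≡ embed m + embed n
  embed-+ m n = sym (trans (cong₂ _+_ (embed-mkℚ m) (embed-mkℚ n))
    (cong (_/ 1) (cong₂ ℤ._+_ (ℤ.*-identityʳ (ℤ.+ m)) (ℤ.*-identityʳ (ℤ.+ n)))))

  embed-* : ∀ m n → embed (m ℕ.* n) ≡ embed m * embed n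
  embed-* m n = sym (trans (cong₂ _*_ (embed-mkℚ m) (embed-mkℚ n))
    (cong (_/ 1) (sym (ℤ.pos-* m n))))

  embed-nonNeg : ∀ n → 0ℚ ≤ embed n
  embed-nonNeg n = nonNegative⁻¹ (embed n) {{normalize-nonNeg n 1}}

  embed-mono : ∀ {m n} → m ℕ.≤ n → embed m ≤ embed n
  embed-mono {m} {n} m≤n = ≡+⇒≤ (embed (n ℕ.∸ m)) (embed-nonNeg (n ℕ.∸ m))
    (trans (cong embed (sym (ℕ.m+[n∸m]≡n m≤n))) (embed-+ m (n ℕ.∸ m)))

  embed-cancel-< : ∀ {m n} → embed m < embed n → m ℕ.< n
  embed-cancel-< m<n = ℕ.≰⇒> λ n≤m → <-irrefl refl (<-≤-trans m<n (embed-mono n≤m))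

  embed-sum : ∀ {n} (f : Fin n → ℕ) → embed (Σℕ.sum f) ≡ sum (embed ∘ f)
  embed-sum {zero}  f = refl
  embed-sum {suc n} f = trans (embed-+ (f zero) _) (cong (embed (f zero) +_) (embed-sum (f ∘ suc)))

  seq-sum : ∀ {n} (f : Fin n → ℝ) i → seq (Σℝ.sum f) i ≡ sum (λ j → seq (f j) i)
  seq-sum {zero}  f i = refl
  seq-sum {suc n} f i = cong (seq (f zero) i +_) (seq-sum (f ∘ suc) i)

  seq-product : ∀ {n} (f : Fin n → ℝ) i → seq (Σℝ.product f) i ≡ product (λ j → seq (f j) i)
  seq-product {zero}  f i = refl
  seq-product {suc n} f i = cong (seq (f zero) i *_) (seq-product (f ∘ suc) i)

  seq-sign : ∀ {n} (j : Fin n) i → seq ((-ᵣ 1ᵣ) Σℝ.^ toℕ j) i ≡ sgn j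
  seq-sign zero    i = refl
  seq-sign (suc j) i = trans (cong (- 1ℚ *_) (seq-sign j i))
    (solve 1 (λ s → :- con 1ℚ :* s := :- s) refl (sgn j))

  seq-det : ∀ {n} (A : Matrix n) i → seq (det A) i ≡ detℚ (λ a b → seq (A a b) i)
  seq-det {zero}  A i = refl
  seq-det {suc n} A i = trans
    (seq-sum (λ j → ((-ᵣ 1ᵣ) Σℝ.^ toℕ j) *ᵣ (A zero j *ᵣ det (λ a b → A (suc a) (punchIn j b)))) i)
    (sum-cong-≗ λ j → cong₂ (λ s d → s * (seq (A zero j) i * d)) (seq-sign j i)
      (seq-det (λ a b → A (suc a) (punchIn j b)) i))

  δ-off : ∀ {n} {a b : Fin n} → a ≢ b → δ a b ≡ 0ℚ
  δ-off {a = zero}  {zero}  a≢b = contradiction refl a≢b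
  δ-off {a = zero}  {suc b} a≢b = refl
  δ-off {a = suc a} {zero}  a≢b = refl
  δ-off {a = suc a} {suc b} a≢b = δ-off (a≢b ∘ cong suc)

  seq-diag : ∀ {n} (d : Fin n → ℝ) a b i → seq (diag d a b) i ≡ seq (d a) i * δ a b
  seq-diag d a b i with a Fin.≟ b
  ... | yes refl = sym (trans (cong (seq (d a) i *_) (δ-refl a)) (*-identityʳ (seq (d a) i)))
  ... | no a≢b   = sym (trans (cong (seq (d a) i *_) (δ-off a≢b)) (*-zeroʳ (seq (d a) i)))

  detℚ-neg : ∀ {n} (A : Matrixℚ n) → detℚ (λ a b → - A a b) ≡ (- 1ℚ) ^ n * detℚ A
  detℚ-neg {zero}  A = refl
  detℚ-neg {suc n} A = trans (sum-cong-≗ λ j → begin-equality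
      sgn j * (- A zero j * detℚ (λ a b → - minor A j a b))
        ≡⟨ cong (λ d → sgn j * (- A zero j * d)) (detℚ-neg (minor A j)) ⟩
      sgn j * (- A zero j * ((- 1ℚ) ^ n * detℚ (minor A j)))
        ≡⟨ solve 4 (λ s a e d → s :* (:- a :* (e :* d)) := :- con 1ℚ :* e :* (s :* (a :* d))) refl
             (sgn j) (A zero j) ((- 1ℚ) ^ n) (detℚ (minor A j)) ⟩
      - 1ℚ * (- 1ℚ) ^ n * (sgn j * (A zero j * detℚ (minor A j)))
        ∎)
    (sym (*-distribˡ-sum ((- 1ℚ) ^ suc n) (λ j → sgn j * (A zero j * detℚ (minor A j)))))

  product-neg : ∀ {n} (f : Fin n → ℚ) → product (λ i → - f i) ≡ (- 1ℚ) ^ n * product f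
  product-neg {zero}  f = refl
  product-neg {suc n} f = trans (cong (- f zero *_) (product-neg (f ∘ suc)))
    (solve 3 (λ a e p → :- a :* (e :* p) := :- con 1ℚ :* e :* (a :* p)) refl
      (f zero) ((- 1ℚ) ^ n) (product (f ∘ suc)))

  ∣-1^n*p∣ : ∀ n p → ∣ (- 1ℚ) ^ n * p ∣ ≡ ∣ p ∣
  ∣-1^n*p∣ zero    p = cong ∣_∣ (*-identityˡ p)
  ∣-1^n*p∣ (suc n) p = trans
    (cong ∣_∣ (solve 2 (λ e p → :- con 1ℚ :* e :* p := :- (e :* p)) refl ((- 1ℚ) ^ n) p))
    (trans (∣-p∣≡∣p∣ ((- 1ℚ) ^ n * p)) (∣-1^n*p∣ n p))

  product-zero : ∀ {n} (f : Fin n → ℚ) i → f i ≡ 0ℚ → product f ≡ 0ℚ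
  product-zero {suc n} f zero    fi≡0 = trans (cong (_* product (f ∘ suc)) fi≡0) (*-zeroˡ (product (f ∘ suc)))
  product-zero {suc n} f (suc i) fi≡0 =
    trans (cong (f zero *_) (product-zero (f ∘ suc) i fi≡0)) (*-zeroʳ (f zero))

  -- The shifted Laplacian and the characteristic polynomial.

  module _ {n} (G : SimpleGraph n) where
    open SimpleGraph G

    adjℚ : Fin n → Fin n → ℚ
    adjℚ a b = if adj a b then 1ℚ else 0ℚ

    degreeℚ : Fin n → ℚ
    degreeℚ a = embed (degree G a)

    -- The matrix L + s I; at s = - x it is the negative of x I - L.
    shiftedLaplacian : ℚ → Matrixℚ n
    shiftedLaplacian s a b = (degreeℚ a + s) * δ a b - adjℚ a b

    adjℚ-nonNeg : ∀ a b → 0ℚ ≤ adjℚ a b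
    adjℚ-nonNeg a b with adj a b
    ... | true  = 0≤1
    ... | false = ≤-refl

    degreeℚ≡sum : ∀ a → degreeℚ a ≡ sum (adjℚ a)
    degreeℚ≡sum a = trans (embed-sum λ b → if adj a b then 1 else 0)
      (sum-cong-≗ λ b → if-float embed (adj a b))

    diagonal : ∀ s a → shiftedLaplacian s a a ≡ degreeℚ a + s
    diagonal s a = begin-equality
      (degreeℚ a + s) * δ a a - adjℚ a a
        ≡⟨ cong₂ (λ e b → (degreeℚ a + s) * e - (if b then 1ℚ else 0ℚ)) (δ-refl a) (irrefl a) ⟩
      (degreeℚ a + s) * 1ℚ - 0ℚ
        ≡⟨ solve 1 (λ x → x :* con 1ℚ :- con 0ℚ := x) refl (degreeℚ a + s) ⟩
      degreeℚ a + s
        ∎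

    -- The rows of L sum to zero, so those of L + s I sum to s.
    shiftedLaplacian-dominant : ∀ {s} → 1ℚ ≤ s → Dominant (shiftedLaplacian s)
    shiftedLaplacian-dominant {s} 1≤s = record
      { offDiagonal = λ a b a≢b → ≤-trans (≤-reflexive (begin-equality
          (degreeℚ a + s) * δ a b - adjℚ a b
            ≡⟨ cong (λ e → (degreeℚ a + s) * e - adjℚ a b) (δ-off a≢b) ⟩
          (degreeℚ a + s) * 0ℚ - adjℚ a b
            ≡⟨ solve 2 (λ x y → x :* con 0ℚ :- y := :- y) refl (degreeℚ a + s) (adjℚ a b) ⟩
          - adjℚ a b
            ∎)) (neg-antimono-≤ (adjℚ-nonNeg a b))
      ; rowSum = λ a → ≤-trans 1≤s (≤-reflexive (sym (begin-equality
          sum (λ b → (degreeℚ a + s) * δ a b - adjℚ a b)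
            ≡⟨ ∑-distrib-+ (λ b → (degreeℚ a + s) * δ a b) (λ b → - adjℚ a b) ⟩
          sum (λ b → (degreeℚ a + s) * δ a b) + sum (λ b → - adjℚ a b)
            ≡⟨ cong₂ _+_ (*-distribˡ-sum (degreeℚ a + s) (δ a)) (sum-neg (adjℚ a)) ⟨
          (degreeℚ a + s) * sum (δ a) + - sum (adjℚ a)
            ≡⟨ cong₂ (λ e d → (degreeℚ a + s) * e + - d) (sum-δ a) (sym (degreeℚ≡sum a)) ⟩
          (degreeℚ a + s) * 1ℚ + - degreeℚ a
            ≡⟨ solve 2 (λ d s → (d :+ s) :* con 1ℚ :+ :- d := s) refl (degreeℚ a) s ⟩
          s ∎)))
      }
      where
      sum-neg : ∀ {n} (f : Fin n → ℚ) → - sum f ≡ sum (λ i → - f i)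
      sum-neg {zero}  f = refl
      sum-neg {suc n} f = trans (neg-distrib-+ (f zero) _) (cong (- f zero +_) (sum-neg (f ∘ suc)))

    seq-charPoly : ∀ x i →
      seq (charPoly (laplacian G) x) i ≡ (- 1ℚ) ^ n * detℚ (shiftedLaplacian (- seq x i))
    seq-charPoly x i = trans (seq-det (diag (λ _ → x) -ₘ laplacian G) i)
      (trans (detℚ-cong entry) (detℚ-neg (shiftedLaplacian (- seq x i))))
      where
      entry : ∀ a b → seq ((diag (λ _ → x) -ₘ laplacian G) a b) i ≡
        - shiftedLaplacian (- seq x i) a b
      entry a b = begin-equality
        seq (diag (λ _ → x) a b) i - (seq (diag (λ c → fromℕ (degree G c)) a b) i - seq (adjacencyMatrix G a b) i)
          ≡⟨ cong₂ _-_ (seq-diag (λ _ → x) a b i)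
               (cong₂ _-_ (seq-diag (λ c → fromℕ (degree G c)) a b i) (if-float (λ y → seq y i) (adj a b))) ⟩
        seq x i * δ a b - (degreeℚ a * δ a b - adjℚ a b)
          ≡⟨ solve 4 (λ x e d c → x :* e :- (d :* e :- c) := :- ((d :+ :- x) :* e :- c)) refl
               (seq x i) (δ a b) (degreeℚ a) (adjℚ a b) ⟩
        - shiftedLaplacian (- seq x i) a b
          ∎

    -- Reversing all signs in x I - L and in the factors x - μⱼ multiplies both sides of `roots` by
    -- the same power of -1, which the absolute value removes.
    eigenvalue-product : ∀ {μ} → IsSpectrum (laplacian G) μ → ∀ x ε → 0ℚ < ε →
      ∃ λ N → ∀ i → N ℕ.≤ i →
        ∣ detℚ (shiftedLaplacian (- seq x i)) - product (λ j → seq (μ j) i - seq x i) ∣ < ε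
    eigenvalue-product {μ} spec x ε ε>0 = proj₁ close , λ i N≤i →
      subst (_< ε) (eq i) (proj₂ close i N≤i)
      where
      close = IsSpectrum.roots spec x ε ε>0
      eq : ∀ i → ∣ seq (charPoly (laplacian G) x) i - seq (Σℝ.product (λ j → x -ᵣ μ j)) i ∣ ≡
        ∣ detℚ (shiftedLaplacian (- seq x i)) - product (λ j → seq (μ j) i - seq x i) ∣
      eq i = begin-equality
        ∣ seq (charPoly (laplacian G) x) i - seq (Σℝ.product (λ j → x -ᵣ μ j)) i ∣
          ≡⟨ cong₂ (λ p q → ∣ p - q ∣) (seq-charPoly x i) (seq-product (λ j → x -ᵣ μ j) i) ⟩
        ∣ e * d - product (λ j → seq x i - seq (μ j) i) ∣
          ≡⟨ cong (λ p → ∣ e * d - p ∣) (trans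
               (product-cong λ j → solve 2 (λ x m → x :- m := :- (m :- x)) refl (seq x i) (seq (μ j) i))
               (product-neg λ j → seq (μ j) i - seq x i)) ⟩
        ∣ e * d - e * p ∣
          ≡⟨ cong ∣_∣ (solve 3 (λ e d p → e :* d :- e :* p := e :* (d :- p)) refl e d p) ⟩
        ∣ e * (d - p) ∣
          ≡⟨ ∣-1^n*p∣ n (d - p) ⟩
        ∣ d - p ∣
          ∎
        where
        e = (- 1ℚ) ^ n
        d = detℚ (shiftedLaplacian (- seq x i))
        p = product λ j → seq (μ j) i - seq x i

  -- Properties of all sufficiently large indices, and auxiliary estimates.

  Eventually : (ℕ → Set) → Set
  Eventually P = ∃ λ N → ∀ i → N ℕ.≤ i → P i

  eventually-× : ∀ {P Q : ℕ → Set} → Eventually P → Eventually Q → Eventually λ i → P i × Q i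
  eventually-× (M , p) (N , q) = M ℕ.⊔ N , λ i M⊔N≤i →
    p i (ℕ.m⊔n≤o⇒m≤o M N M⊔N≤i) , q i (ℕ.m⊔n≤o⇒n≤o M N M⊔N≤i)

  eventually-map : ∀ {P Q : ℕ → Set} → (∀ {i} → P i → Q i) → Eventually P → Eventually Q
  eventually-map f (N , p) = N , λ i N≤i → f (p i N≤i)

  eventually-∀ : ∀ {n} {P : Fin n → ℕ → Set} →
    (∀ j → Eventually (P j)) → Eventually λ i → ∀ j → P j i
  eventually-∀ {zero}      p = 0 , λ _ _ ()
  eventually-∀ {suc n} {P} p = eventually-map
    {P = λ i → P zero i × (∀ j → P (suc j) i)} {Q = λ i → ∀ j → P j i}
    (λ { (p₀ , pₛ) zero → p₀ ; (p₀ , pₛ) (suc j) → pₛ j })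
    (eventually-× {P = P zero} {Q = λ i → ∀ j → P (suc j) i} (p zero) (eventually-∀ (p ∘ suc)))

  p≤∣p∣ : ∀ p → p ≤ ∣ p ∣
  p≤∣p∣ p with ≤-total 0ℚ p
  ... | inj₁ 0≤p = ≤-reflexive (sym (0≤p⇒∣p∣≡p 0≤p))
  ... | inj₂ p≤0 = ≤-trans p≤0 (0≤∣p∣ p)

  ∣p-q∣<ε⇒p<q+ε : ∀ p q {ε} → ∣ p - q ∣ < ε → p < q + ε
  ∣p-q∣<ε⇒p<q+ε p q {ε} close = begin-strict
    p            ≡⟨ solve 2 (λ p q → p := q :+ (p :- q)) refl p q ⟩
    q + (p - q)  <⟨ +-monoʳ-< q (≤-<-trans (p≤∣p∣ (p - q)) close) ⟩
    q + ε        ∎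

  ∣p-q∣<ε⇒q<p+ε : ∀ p q {ε} → ∣ p - q ∣ < ε → q < p + ε
  ∣p-q∣<ε⇒q<p+ε p q {ε} close = ∣p-q∣<ε⇒p<q+ε q p
    (subst (_< ε) (trans (sym (∣-p∣≡∣p∣ (p - q)))
      (cong ∣_∣ (solve 2 (λ p q → :- (p :- q) := q :- p) refl p q))) close)

  sum-inject≤ : ∀ {k n} (f : Fin n → ℚ) .(k≤n : k ℕ.≤ n) → (∀ i → 0ℚ ≤ f i) →
    sum (λ i → f (inject≤ i k≤n)) ≤ sum f
  sum-inject≤ {zero}          f k≤n 0≤f = sum-nonNeg 0≤f
  sum-inject≤ {suc k} {suc n} f k≤n 0≤f =
    +-monoʳ-≤ (f zero) (sum-inject≤ (f ∘ suc) (ℕ.s≤s⁻¹ k≤n) (0≤f ∘ suc))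

  sum-ones : ∀ n → sum {n} (λ _ → 1ℚ) ≡ embed n
  sum-ones zero    = refl
  sum-ones (suc n) = trans (cong (1ℚ +_) (sum-ones n)) (sym (embed-+ 1 n))

  sum-+1 : ∀ {n} (f : Fin n → ℚ) → sum (λ i → f i + 1ℚ) ≡ sum f + embed n
  sum-+1 {n} f = trans (∑-distrib-+ f _) (cong (sum f +_) (sum-ones n))

  -- Bounds on the eigenvalues and on their partial sums.

  module _ {n} (G : SimpleGraph n) where

    -- At x = μ j the product of the x - μ l vanishes at every index, while the determinant is at least 1
    -- at the indices where - x ≥ 1.
    eigenvalue-lower : ∀ {μ} → IsSpectrum (laplacian G) μ → ∀ j →
      Eventually λ i → 0ℚ ≤ seq (μ j) i + 1ℚ
    eigenvalue-lower {μ} spec j = proj₁ close , λ i N≤i → ≮⇒≥ λ q+1<0 →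
      <-irrefl refl (begin-strict
        1ℚ
          ≤⟨ 1≤detℚ (shiftedLaplacian-dominant G (1≤-q i q+1<0)) ⟩
        detℚ (shiftedLaplacian G (- seq (μ j) i))
          <⟨ ∣p-q∣<ε⇒p<q+ε _ _ (proj₂ close i N≤i) ⟩
        product (λ l → seq (μ l) i - seq (μ j) i) + 1ℚ
          ≡⟨ cong (_+ 1ℚ) (product-zero (λ l → seq (μ l) i - seq (μ j) i) j (+-inverseʳ (seq (μ j) i))) ⟩
        1ℚ
          ∎)
      where
      close = eigenvalue-product G spec (μ j) 1ℚ 0<1
      1≤-q : ∀ i → seq (μ j) i + 1ℚ < 0ℚ → 1ℚ ≤ - seq (μ j) i
      1≤-q i q+1<0 = begin
        1ℚ
          ≡⟨ solve 1 (λ q → con 1ℚ := (q :+ con 1ℚ) :- q) refl (seq (μ j) i) ⟩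
        (seq (μ j) i + 1ℚ) - seq (μ j) i
          ≤⟨ +-monoˡ-≤ (- seq (μ j) i) (<⇒≤ q+1<0) ⟩
        0ℚ - seq (μ j) i
          ≡⟨ +-identityˡ (- seq (μ j) i) ⟩
        - seq (μ j) i
          ∎

    -- The characteristic polynomial is evaluated at x = -(t + 1), so that the eigenvalue factors
    -- become t + (μⱼ + 1) and the diagonal entries t + (dₐ + 1), the shape `sum-bound` expects.
    -- Precision 1 in `roots` matches the `+ 1ℚ` there.
    eigenvalue-sum : 2 ℕ.≤ n → ∀ {μ} → IsSpectrum (laplacian G) μ → Eventually λ i →
      (∀ j → 0ℚ ≤ seq (μ j) i + 1ℚ) ×
      sum (λ j → seq (μ j) i + 1ℚ) ≤ sum (λ a → degreeℚ G a + 1ℚ) + 1ℚ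
    eigenvalue-sum (ℕ.s≤s (ℕ.s≤s _)) {μ} spec = eventually-map
      {P = λ i → (∀ j → 0ℚ ≤ x i j) × ∣ detℚ M - product (λ j → seq (μ j) i - - (t + 1ℚ)) ∣ < 1ℚ}
      {Q = λ i → (∀ j → 0ℚ ≤ x i j) × sum (x i) ≤ sum d + 1ℚ}
      (λ { {i} (0≤x , close) → 0≤x , sum-bound (x i) d 0≤x 0≤d (begin
        product (λ j → t + x i j)
          ≡⟨ product-cong (λ j → solve 2 (λ t m → t :+ (m :+ con 1ℚ) := m :- :- (t :+ con 1ℚ)) refl t (seq (μ j) i)) ⟩
        product (λ j → seq (μ j) i - - (t + 1ℚ))
          ≤⟨ <⇒≤ (∣p-q∣<ε⇒q<p+ε (detℚ M) _ close) ⟩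
        detℚ M + 1ℚ
          ≤⟨ +-monoˡ-≤ 1ℚ (detℚ≤product (shiftedLaplacian-dominant G 1≤s)) ⟩
        product (λ a → M a a) + 1ℚ
          ≡⟨ cong (_+ 1ℚ) (product-cong λ a → trans (diagonal G (- - (t + 1ℚ)) a)
               (solve 2 (λ t d → d :+ :- :- (t :+ con 1ℚ) := t :+ (d :+ con 1ℚ)) refl t (degreeℚ G a))) ⟩
        product (λ a → t + d a) + 1ℚ
          ∎) })
      (eventually-× {P = λ i → ∀ j → 0ℚ ≤ x i j}
        {Q = λ i → ∣ detℚ M - product (λ j → seq (μ j) i - - (t + 1ℚ)) ∣ < 1ℚ}
        (eventually-∀ {P = λ j i → 0ℚ ≤ x i j} (eigenvalue-lower spec))
        (eigenvalue-product G spec (fromℚ (- (t + 1ℚ))) 1ℚ 0<1))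
      where
      x : ℕ → Fin n → ℚ
      x i j = seq (μ j) i + 1ℚ
      d : Fin n → ℚ
      d a = degreeℚ G a + 1ℚ
      0≤d : ∀ a → 0ℚ ≤ d a
      0≤d a = +-mono-≤ (embed-nonNeg (degree G a)) 0≤1
      t : ℚ
      t = largePoint (sum d)
      M : Matrixℚ n
      M = shiftedLaplacian G (- - (t + 1ℚ))
      1≤s : 1ℚ ≤ - - (t + 1ℚ)
      1≤s = ≡+⇒≤ t
        (+-mono-≤ (+-mono-≤ (*-nonNeg (sum-nonNeg 0≤d) (sum-nonNeg 0≤d)) (sum-nonNeg 0≤d)) 0≤1)
        (solve 1 (λ t → :- :- (t :+ con 1ℚ) := con 1ℚ :+ t) refl t)

    -- As the μⱼ + 1 are eventually nonnegative, any k of them sum to at most the total; subtracting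
    -- k then leaves the bound on S.
    S-upper : 2 ℕ.≤ n → ∀ {μ} → IsSpectrum (laplacian G) μ → ∀ {k c} (k≤n : k ℕ.≤ n) →
      Σℕ.sum (degree G) ℕ.+ n ℕ.+ 1 ℕ.≤ c ℕ.+ k → S μ k k≤n ≤ᵣ fromℕ c
    S-upper n≥2 {μ} spec {k} {c} k≤n Σd+n+1≤c+k ε ε>0 = eventually-map
      {P = λ i → (∀ j → 0ℚ ≤ seq (μ j) i + 1ℚ) ×
        sum (λ j → seq (μ j) i + 1ℚ) ≤ sum (λ a → degreeℚ G a + 1ℚ) + 1ℚ}
      {Q = λ i → seq (S μ k k≤n) i < embed c + ε}
      (λ { {i} (0≤x , bound) → begin-strict
        seq (S μ k k≤n) i
          ≡⟨ seq-sum (λ j → μ (inject≤ j k≤n)) i ⟩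
        s i
          ≡⟨ solve 2 (λ s k → s := (s :+ k) :- k) refl (s i) (embed k) ⟩
        (s i + embed k) - embed k
          ≡⟨ cong (_- embed k) (sum-+1 λ (j : Fin k) → seq (μ (inject≤ j k≤n)) i) ⟨
        sum (λ (j : Fin k) → seq (μ (inject≤ j k≤n)) i + 1ℚ) - embed k
          ≤⟨ +-monoˡ-≤ (- embed k) (≤-trans (sum-inject≤ (λ j → seq (μ j) i + 1ℚ) k≤n 0≤x) bound) ⟩
        (sum (λ a → degreeℚ G a + 1ℚ) + 1ℚ) - embed k
          ≡⟨ cong (λ z → (z + 1ℚ) - embed k) (trans (sum-+1 (degreeℚ G))
               (cong (_+ embed n) (sym (embed-sum (degree G))))) ⟩
        (embed (Σℕ.sum (degree G)) + embed n + embed 1) - embed k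
          ≡⟨ cong (_- embed k) (trans (embed-+ (Σℕ.sum (degree G) ℕ.+ n) 1) (cong (_+ embed 1) (embed-+ (Σℕ.sum (degree G)) n))) ⟨
        embed (Σℕ.sum (degree G) ℕ.+ n ℕ.+ 1) - embed k
          ≤⟨ +-monoˡ-≤ (- embed k) (embed-mono Σd+n+1≤c+k) ⟩
        embed (c ℕ.+ k) - embed k
          ≡⟨ cong (_- embed k) (embed-+ c k) ⟩
        (embed c + embed k) - embed k
          ≡⟨ solve 2 (λ c k → (c :+ k) :- k := c :+ con 0ℚ) refl (embed c) (embed k) ⟩
        embed c + 0ℚ
          <⟨ +-monoʳ-< (embed c) ε>0 ⟩
        embed c + ε
          ∎ })
      (eigenvalue-sum n≥2 spec)
      where
      s : ℕ → ℚ
      s i = sum λ (j : Fin k) → seq (μ (inject≤ j k≤n)) i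

  -- Rational estimates for the nested square root.

  ¼ : ℚ
  ¼ = ½ * ½

  square-mono : ∀ {p q} → - q ≤ p → p ≤ q → p * p ≤ q * q
  square-mono {p} {q} -q≤p p≤q = ≡+⇒≤ ((q - p) * (p + q))
    (*-nonNeg
      (≤-trans (≤-reflexive (sym (+-inverseʳ p))) (+-monoˡ-≤ (- p) p≤q))
      (≤-trans (≤-reflexive (sym (+-inverseˡ q))) (+-monoˡ-≤ q -q≤p)))
    (solve 2 (λ p q → q :* q := p :* p :+ (q :- p) :* (p :+ q)) refl p q)

  0<p+q⇒-q<p : ∀ {p q} → 0ℚ < p + q → - q < p
  0<p+q⇒-q<p {p} {q} 0<p+q = begin-strict
    - q            ≡⟨ +-identityˡ (- q) ⟨
    0ℚ - q         <⟨ +-monoˡ-< (- q) 0<p+q ⟩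
    (p + q) - q    ≡⟨ solve 2 (λ p q → (p :+ q) :- q := p) refl p q ⟩
    p              ∎

  -- The case u = 1 has to be excluded because (1 - ¼)² + ½ > 1.
  sqrt-lower : ∀ u {c r} → embed (u ℕ.* u) ≤ c → u ≡ 0 ⊎ 2 ℕ.≤ u →
    0ℚ < r + ¼ → ∣ r * r - c ∣ < ½ → embed u - ¼ ≤ r
  sqrt-lower .0 {c} {r} u²≤c (inj₁ refl) 0<r+¼ close = <⇒≤ (0<p+q⇒-q<p 0<r+¼)
  sqrt-lower u {c} {r} u²≤c (inj₂ 2≤u) 0<r+¼ close = ≮⇒≥ λ r<u-¼ → <-irrefl refl (begin-strict
    c
      <⟨ ∣p-q∣<ε⇒q<p+ε (r * r) c close ⟩
    r * r + ½
      ≤⟨ +-monoˡ-≤ ½ (square-mono {r} {q - ¼} (≤-trans 1/4≤ (<⇒≤ (0<p+q⇒-q<p 0<r+¼))) (<⇒≤ r<u-¼)) ⟩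
    (q - ¼) * (q - ¼) + ½
      -- The gap q² - (q - ¼)² - ½ is linear in q with slope ½ and equals 7/16 at q = 2.
      ≤⟨ ≡+⇒≤ (½ * (q - embed 2) + ℤ.+ 7 / 16)
           (+-mono-≤ (*-nonNeg (nonNegative⁻¹ ½) 0≤q-2) (nonNegative⁻¹ (ℤ.+ 7 / 16)))
           (solve 1 (λ q → q :* q := (q :- con ¼) :* (q :- con ¼) :+ con ½ :+
             (con ½ :* (q :- con (embed 2)) :+ con (ℤ.+ 7 / 16))) refl q) ⟩
    q * q
      ≡⟨ embed-* u u ⟨
    embed (u ℕ.* u)
      ≤⟨ u²≤c ⟩
    c
      ∎)
    where
    q = embed u
    0≤q-2 : 0ℚ ≤ q - embed 2
    0≤q-2 = ≤-trans (≤-reflexive (sym (+-inverseʳ (embed 2)))) (+-monoˡ-≤ (- embed 2) (embed-mono 2≤u))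
    1/4≤ : - (q - ¼) ≤ - ¼
    1/4≤ = ≡+⇒≤ ((q - embed 2) + ℤ.+ 3 / 2) (+-mono-≤ 0≤q-2 (nonNegative⁻¹ (ℤ.+ 3 / 2)))
      (solve 1 (λ q → :- con ¼ := :- (q :- con ¼) :+ ((q :- con (embed 2)) :+ con (ℤ.+ 3 / 2))) refl q)

  -- The error budget is exact: ½ from doubling the error of r, ¼ from ℓ², and ¼ from (k + ½)² = k²
  -- + k + ¼ add up to 1. A strict bound by k² + k + 1 loses nothing against k² + k, since both
  -- sides are integers.
  sqrt-upper : ∀ a b k {r ℓ} → embed b - ¼ ≤ r → 0ℚ < ℓ + ½ → ℓ < embed k + ½ →
    ∣ ℓ * ℓ - (embed a - embed b + embed 2 * r) ∣ < ¼ → a ℕ.+ b ℕ.< k ℕ.* k ℕ.+ k ℕ.+ 1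
  sqrt-upper a b k {r} {ℓ} b-¼≤r 0<ℓ+½ ℓ<k+½ close = embed-cancel-< (begin-strict
    embed (a ℕ.+ b)
      ≡⟨ embed-+ a b ⟩
    A + B
      ≤⟨ ≡+⇒≤ (embed 2 * (r - (B - ¼)))
           (*-nonNeg (nonNegative⁻¹ (embed 2))
             (≤-trans (≤-reflexive (sym (+-inverseʳ (B - ¼)))) (+-monoˡ-≤ (- (B - ¼)) b-¼≤r)))
           (solve 3 (λ a b r → (a :- b :+ con (embed 2) :* r) :+ con ½ :=
             a :+ b :+ con (embed 2) :* (r :- (b :- con ¼))) refl A B r) ⟩
    (A - B + embed 2 * r) + ½
      <⟨ +-monoˡ-< ½ (∣p-q∣<ε⇒q<p+ε (ℓ * ℓ) _ close) ⟩
    (ℓ * ℓ + ¼) + ½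
      ≤⟨ +-monoˡ-≤ ½ (+-monoˡ-≤ ¼ (square-mono -k-½≤ℓ (<⇒≤ ℓ<k+½))) ⟩
    ((K + ½) * (K + ½) + ¼) + ½
      ≡⟨ solve 1 (λ k → ((k :+ con ½) :* (k :+ con ½) :+ con ¼) :+ con ½ := k :* k :+ k :+ con (embed 1)) refl K ⟩
    K * K + K + embed 1
      ≡⟨ cong (λ z → z + K + embed 1) (embed-* k k) ⟨
    embed (k ℕ.* k) + K + embed 1
      ≡⟨ trans (embed-+ (k ℕ.* k ℕ.+ k) 1) (cong (_+ embed 1) (embed-+ (k ℕ.* k) k)) ⟨
    embed (k ℕ.* k ℕ.+ k ℕ.+ 1)
      ∎)
    where
    A B K : ℚ
    A = embed a
    B = embed b
    K = embed k
    -k-½≤ℓ : - (K + ½) ≤ ℓ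
    -k-½≤ℓ = ≤-trans
      (≡+⇒≤ K (embed-nonNeg k) (solve 1 (λ k → :- con ½ := :- (k :+ con ½) :+ k) refl K))
      (<⇒≤ (0<p+q⇒-q<p 0<ℓ+½))

  -- The conclusion concerns naturals only, so it is enough to have all five approximations, with
  -- tolerances ¼ and ½, at one common index.
  nested-sqrt-bound : ∀ {a b c k} {r ℓ : ℝ} → b ≡ 0 ⊎ 2 ℕ.≤ b → b ℕ.* b ℕ.≤ c →
    r IsSqrtOf fromℕ c → ℓ IsSqrtOf (fromℕ a -ᵣ fromℕ b +ᵣ fromℕ 2 *ᵣ r) → ℓ ≤ᵣ fromℕ k →
    a ℕ.+ b ℕ.< k ℕ.* k ℕ.+ k ℕ.+ 1
  nested-sqrt-bound {a} {b} {c} {k} {r} {ℓ} b≡0⊎2≤b b²≤c (0≤r , r²≈c) (0≤ℓ , ℓ²≈) ℓ≤k =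
    sqrt-upper a b k
      (sqrt-lower b {r = seq r (proj₁ all)} (embed-mono b²≤c) b≡0⊎2≤b (proj₁ at-N) (proj₁ (proj₂ at-N)))
      (proj₁ (proj₂ (proj₂ at-N))) (proj₁ (proj₂ (proj₂ (proj₂ at-N))))
      (proj₂ (proj₂ (proj₂ (proj₂ at-N))))
    where
    P₁ P₂ P₃ P₄ P₅ : ℕ → Set
    P₁ i = 0ℚ < seq r i + ¼
    P₂ i = ∣ seq r i * seq r i - embed c ∣ < ½
    P₃ i = 0ℚ < seq ℓ i + ½
    P₄ i = seq ℓ i < embed k + ½
    P₅ i = ∣ seq ℓ i * seq ℓ i - (embed a - embed b + embed 2 * seq r i) ∣ < ¼
    0<½ : 0ℚ < ½
    0<½ = positive⁻¹ ½
    0<¼ : 0ℚ < ¼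
    0<¼ = positive⁻¹ ¼
    all : Eventually λ i → P₁ i × P₂ i × P₃ i × P₄ i × P₅ i
    all = eventually-× {P₁} {λ i → P₂ i × P₃ i × P₄ i × P₅ i} (0≤r ¼ 0<¼)
      (eventually-× {P₂} {λ i → P₃ i × P₄ i × P₅ i} (r²≈c ½ 0<½)
        (eventually-× {P₃} {λ i → P₄ i × P₅ i} (0≤ℓ ½ 0<½)
          (eventually-× {P₄} {P₅} (ℓ≤k ½ 0<½) (ℓ²≈ ¼ 0<¼))))
    at-N = proj₂ all (proj₁ all) ℕ.≤-refl

open import Data.Nat.Base using (_+_; _*_; _∸_; _^_; _≤_; _<_; s≤s; z≤n)
open import Data.Nat.Combinatorics using (_C_; nCk+nC[k+1]≡[n+1]C[k+1]; nC1≡n)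
open import Data.Nat.Solver using (module +-*-Solver)
open CommutativeMonoidSum ℕ.+-0-commutativeMonoid
  using (sum; ∑-comm; ∑-distrib-+; sum-cong-≗; sum-remove)
open +-*-Solver
open ℕ.≤-Reasoning

-- Counting edges through degrees.

sum-≤-* : ∀ {n c} (f : Fin n → ℕ) → (∀ i → f i ≤ c) → sum f ≤ n * c
sum-≤-* {zero}  f f≤c = z≤n
sum-≤-* {suc n} f f≤c = ℕ.+-mono-≤ (f≤c zero) (sum-≤-* (f ∘ suc) (f≤c ∘ suc))

module _ {n} (G : SimpleGraph n) where
  open SimpleGraph G

  -- Trichotomy: at most one of the two orders holds, and if neither does then a = b, where
  -- irreflexivity applies. Summed over all pairs, the two terms each count every edge once.
  adjacent≡ordered : ∀ a b → (if adj a b then 1 else 0) ≡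
    (if ⌊ a Fin.<? b ⌋ ∧ adj a b then 1 else 0) + (if ⌊ b Fin.<? a ⌋ ∧ adj b a then 1 else 0)
  adjacent≡ordered a b with a Fin.<? b | b Fin.<? a
  ... | yes a<b | yes b<a = contradiction b<a (ℕ.<-asym a<b)
  ... | yes a<b | no  b≮a = sym (ℕ.+-identityʳ _)
  ... | no  a≮b | yes b<a = cong (if_then 1 else 0) (symm a b)
  ... | no  a≮b | no  b≮a rewrite Fin.toℕ-injective (ℕ.≤-antisym (ℕ.≮⇒≥ b≮a) (ℕ.≮⇒≥ a≮b)) =
    cong (if_then 1 else 0) (irrefl b)

  handshake : sum (degree G) ≡ 2 * numEdges G
  handshake = begin-equality
    sum (degree G)
      ≡⟨ sum-cong-≗ (λ a → trans (sum-cong-≗ (adjacent≡ordered a)) (∑-distrib-+ (e a) λ b → e b a)) ⟩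
    sum (λ a → sum (e a) + sum λ b → e b a)
      ≡⟨ ∑-distrib-+ (sum ∘ e) (λ a → sum λ b → e b a) ⟩
    numEdges G + sum (λ a → sum λ b → e b a)
      ≡⟨ cong (numEdges G +_) (∑-comm e) ⟨
    numEdges G + numEdges G
      ≡⟨ cong (numEdges G +_) (ℕ.+-identityʳ (numEdges G)) ⟨
    2 * numEdges G
      ∎
    where
    e : Fin n → Fin n → ℕ
    e a b = if ⌊ a Fin.<? b ⌋ ∧ adj a b then 1 else 0

degree≤n∸1 : ∀ {n} (G : SimpleGraph n) a → degree G a ≤ n ∸ 1
degree≤n∸1 {suc n} G a = begin
  sum f                    ≡⟨ sum-remove {i = a} f ⟩
  f a + sum (f ∘ punchIn a) ≡⟨ cong (λ b → (if b then 1 else 0) + sum (f ∘ punchIn a)) (irrefl a) ⟩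
  sum (f ∘ punchIn a)      ≤⟨ sum-≤-* (f ∘ punchIn a) (λ b → indicator≤1 (adj a (punchIn a b))) ⟩
  n * 1                    ≡⟨ ℕ.*-identityʳ n ⟩
  n                        ∎
  where
  open SimpleGraph G
  f : Fin (suc n) → ℕ
  f b = if adj a b then 1 else 0
  indicator≤1 : ∀ b → (if b then 1 else 0) ≤ 1
  indicator≤1 true  = ℕ.≤-refl
  indicator≤1 false = z≤n

numEdges-bound : ∀ {n} (G : SimpleGraph n) → 2 * numEdges G ≤ n * (n ∸ 1)
numEdges-bound G = subst (_≤ _) (handshake G) (sum-≤-* (degree G) (degree≤n∸1 G))

-- The binomial coefficient and the final comparison.

2*[1+k]C2 : ∀ k → 2 * (suc k C 2) ≡ k * k + k
2*[1+k]C2 zero    = refl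
2*[1+k]C2 (suc k) = begin-equality
  2 * (suc (suc k) C 2)
    ≡⟨ cong (2 *_) (nCk+nC[k+1]≡[n+1]C[k+1] (suc k) 1) ⟨
  2 * (suc k C 1 + suc k C 2)
    ≡⟨ cong (λ z → 2 * (z + suc k C 2)) (nC1≡n (suc k)) ⟩
  2 * (suc k + suc k C 2)
    ≡⟨ ℕ.*-distribˡ-+ 2 (suc k) (suc k C 2) ⟩
  2 * suc k + 2 * (suc k C 2)
    ≡⟨ cong (2 * suc k +_) (2*[1+k]C2 k) ⟩
  2 * suc k + (k * k + k)
    ≡⟨ solve 1 (λ k → con 2 :* (con 1 :+ k) :+ (k :* k :+ k) :=
         (con 1 :+ k) :* (con 1 :+ k) :+ (con 1 :+ k)) refl k ⟩
  suc k * suc k + suc k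
    ∎

theorem7 : (n : ℕ) (n≥2 : 2 ≤ n) (G : SimpleGraph n) →
    let m = numEdges G in
    (μ : Fin n → ℝ) → IsSpectrum (laplacian G) μ →
    (r ℓ : ℝ) →
    r IsSqrtOf fromℕ (2 * m ^ 2 + m * n * (n ∸ 1)) →
    ℓ IsSqrtOf (fromℕ (2 * n) -ᵣ fromℕ (2 * m) +ᵣ fromℕ 2 *ᵣ r) →
    ℓ <ᵣ upper n m n≥2 →
    (k : ℕ) (k≤n : k ≤ n) →
    ℓ ≤ᵣ fromℕ k → fromℕ k ≤ᵣ upper n m n≥2 →
    S μ k k≤n ≤ᵣ fromℕ (m + suc k C 2)
theorem7 n n≥2 G μ spec r ℓ r-sqrt ℓ-sqrt _ k k≤n ℓ≤k _ = S-upper G n≥2 spec k≤n (begin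
  sum (degree G) + n + 1   ≡⟨ cong (λ d → d + n + 1) (handshake G) ⟩
  -- The surplus 1 left over from the eigenvalue estimate is paid for by k ≥ 1.
  2 * m + n + 1            ≤⟨ ℕ.+-mono-≤ 2m+n≤m+C k≥1 ⟩
  m + suc k C 2 + k        ∎)
  where
  m = numEdges G
  -- Evenness rules out the value 1, for which the estimate of the inner root is too coarse.
  2m≡0⊎2≤2m : ∀ m → 2 * m ≡ 0 ⊎ 2 ≤ 2 * m
  2m≡0⊎2≤2m zero    = inj₁ refl
  2m≡0⊎2≤2m (suc m) = inj₂ (ℕ.*-monoʳ-≤ 2 (s≤s z≤n))
  [2m]²≤ : 2 * m * (2 * m) ≤ 2 * m ^ 2 + m * n * (n ∸ 1)
  [2m]²≤ = begin
    2 * m * (2 * m)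
      ≡⟨ solve 1 (λ m → con 2 :* m :* (con 2 :* m) := con 2 :* m :^ 2 :+ m :* (con 2 :* m)) refl m ⟩
    2 * m ^ 2 + m * (2 * m)
      ≤⟨ ℕ.+-monoʳ-≤ (2 * m ^ 2) (ℕ.*-monoʳ-≤ m (numEdges-bound G)) ⟩
    2 * m ^ 2 + m * (n * (n ∸ 1))
      ≡⟨ cong (2 * m ^ 2 +_) (ℕ.*-assoc m n (n ∸ 1)) ⟨
    2 * m ^ 2 + m * n * (n ∸ 1)
      ∎
  2n+2m≤k²+k : 2 * n + 2 * m ≤ k * k + k
  2n+2m≤k²+k = ℕ.m<1+n⇒m≤n (subst (2 * n + 2 * m <_) (ℕ.+-comm (k * k + k) 1)
    (nested-sqrt-bound {2 * n} {2 * m} {k = k} {r} {ℓ} (2m≡0⊎2≤2m m) [2m]²≤ r-sqrt ℓ-sqrt ℓ≤k))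
  n+m≤C : n + m ≤ suc k C 2
  n+m≤C = ℕ.*-cancelˡ-≤ 2 (begin
    2 * (n + m)       ≡⟨ ℕ.*-distribˡ-+ 2 n m ⟩
    2 * n + 2 * m     ≤⟨ 2n+2m≤k²+k ⟩
    k * k + k         ≡⟨ 2*[1+k]C2 k ⟨
    2 * (suc k C 2)   ∎)
  1≤C⇒1≤k : ∀ k → 1 ≤ suc k C 2 → 1 ≤ k
  1≤C⇒1≤k (suc k) _ = s≤s z≤n
  2m+n≤m+C : 2 * m + n ≤ m + suc k C 2
  2m+n≤m+C = begin
    2 * m + n         ≡⟨ solve 2 (λ m n → con 2 :* m :+ n := m :+ (n :+ m)) refl m n ⟩
    m + (n + m)       ≤⟨ ℕ.+-monoʳ-≤ m n+m≤C ⟩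
    m + suc k C 2     ∎
  -- For k = 0 the binomial coefficient vanishes, while n + m is positive.
  k≥1 : 1 ≤ k
  k≥1 = 1≤C⇒1≤k k (ℕ.≤-trans (ℕ.≤-trans (ℕ.<⇒≤ n≥2) (ℕ.m≤m+n n m)) n+m≤C)
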